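{- Let $n$ be an integer and let $C_n=\sup\{|S\cap[1,n^2]| : S \text{ has the property } D(n)\}$. If $|n|>400$, then $C_n<11.006\,\log|n|$. If $|n|\geq 10^{100}$, then $C_n<8.37\,\log|n|$.
   Context: For a nonzero integer $n$, a set of $m$ (distinct) positive integers $S=\{a_1,a_2,\ldots,a_m\}$ is said to have the property $D(n)$ if $a_ia_j+n$ is a perfect square (the square of an integer, $0$ allowed) for all $1\leq i<j\leq m$. The supremum defining $C_n$ is over all sets $S$ of positive integers with the property $D(n)$, of any size $m$. Here $\log$ denotes the natural logarithm, and $[1,n^2]$ is the closed interval. -}

module Defs where

open import Data.Integer as ℤ using (ℤ; +_)
import Data.Integer.Properties as ℤₚ
open import Data.Integer.Solver using () renaming (module +-*-Solver to ℤSolver)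
open import Data.List using (List; length; filter)
open import Data.List.Relation.Unary.All using (All)
open import Data.List.Relation.Unary.AllPairs using (AllPairs)
open import Data.List.Relation.Unary.Unique.Propositional using (Unique)
open import Data.Nat as ℕ using (ℕ; zero; suc)
import Data.Nat.Properties as ℕₚ
open import Data.Product using (_×_; _,_; ∃-syntax; proj₁; proj₂)
open import Data.Rational
  using (ℚ; mkℚ; 0ℚ; 1ℚ; _+_; _*_; _-_; -_; _÷_; ∣_∣; _<_; _≤_; _/_; 1/_; toℚᵘ;
         Positive; NonNegative; NonZero; positive)
import Data.Rational.Properties as ℚₚ
open import Data.Rational.Solver using (module +-*-Solver)
import Data.Rational.Unnormalised as ℚᵘ
import Data.Rational.Unnormalised.Properties as ℚᵘₚ
open import Data.Sum using (inj₁; inj₂)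
open import Level using (0ℓ)
open import Relation.Binary.PropositionalEquality
open import Relation.Nullary.Decidable using (_×-dec_)
open import Relation.Unary using (Pred)

IsSquare : ℤ → Set
IsSquare x = ∃[ y ] x ≡ y ℤ.* y

-- A finite set of positive integers is a duplicate-free list of them;
-- `AllPairs` ranges over the pairs of positions i < j.
record HasPropertyD (n : ℤ) (S : List ℕ) : Set where
  field
    distinct    : Unique S
    allPositive : All (λ a → 1 ℕ.≤ a) S
    squares     : AllPairs (λ a b → IsSquare (+ a ℤ.* + b ℤ.+ n)) S

∣_∩[1,_]∣ : List ℕ → ℕ → ℕ
∣ S ∩[1, N ]∣ = length (filter (λ a → (1 ℕ.≤? a) ×-dec (a ℕ.≤? N)) S)

IsSupremum : Pred ℕ 0ℓ → ℕ → Set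
IsSupremum P s = (∀ k → P k → k ℕ.≤ s) × (∀ b → (∀ k → P k → k ℕ.≤ b) → s ℕ.≤ b)

-- `IsC n c` says that c is C_n.
IsC : ℤ → ℕ → Set
IsC n = IsSupremum (λ k → ∃[ S ] HasPropertyD n S × k ≡ ∣ S ∩[1, ℤ.∣ n ∣ ℕ.^ 2 ]∣)

record ℝ : Set where
  field
    seq    : ℕ → ℚ
    cauchy : ∀ ε → 0ℚ < ε →
             ∃[ M ] ∀ i j → M ℕ.≤ i → M ℕ.≤ j → ∣ seq i - seq j ∣ < ε

open ℝ public

infix 4 _<ᵣ_

_<ᵣ_ : ℝ → ℝ → Set
x <ᵣ y = ∃[ ε ] 0ℚ < ε × ∃[ M ] ∀ i → M ℕ.≤ i → seq x i + ε < seq y i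

fromℚ : ℚ → ℝ
fromℚ q .seq _ = q
fromℚ q .cauchy ε 0<ε = 0 , λ _ _ _ _ →
  subst (_< ε) (sym (cong ∣_∣ (ℚₚ.+-inverseʳ q))) 0<ε

fromℕ : ℕ → ℝ
fromℕ k = fromℚ (+ k / 1)

infixl 7 _·_

_·_ : ℚ → ℝ → ℝ
(q · x) .seq i = q * seq x i
(q · x) .cauchy ε 0<ε = M , bound
  where
  open ℚₚ.≤-Reasoning
  B = 1ℚ + ∣ q ∣
  instance
    nonNeg : NonNegative ∣ q ∣
    nonNeg = ℚₚ.∣-∣-nonNeg q
    B-pos : Positive B
    B-pos = positive (ℚₚ.+-mono-<-≤ {0ℚ} {1ℚ} (ℚₚ.positive⁻¹ 1ℚ) (ℚₚ.0≤∣p∣ q))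
    B-nz : NonZero B
    B-nz = ℚₚ.pos⇒nonZero B
    1/B-pos : Positive (1/ B)
    1/B-pos = ℚₚ.1/pos⇒pos B
  δ = ε ÷ B
  0<δ : 0ℚ < δ
  0<δ = subst (_< δ) (ℚₚ.*-zeroˡ (1/ B)) (ℚₚ.*-monoˡ-<-pos (1/ B) 0<ε)
  M = proj₁ (cauchy x δ 0<δ)
  Bδ≡ε : B * δ ≡ ε
  Bδ≡ε = trans (ℚₚ.*-comm B δ) (trans (ℚₚ.*-assoc ε (1/ B) B)
    (trans (cong (ε *_) (ℚₚ.*-inverseˡ B)) (ℚₚ.*-identityʳ ε)))
  bound : ∀ i j → M ℕ.≤ i → M ℕ.≤ j → ∣ q * seq x i - q * seq x j ∣ < ε
  bound i j M≤i M≤j = begin-strict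
    ∣ q * seq x i - q * seq x j ∣   ≡⟨ cong ∣_∣ (solve 3 (λ q a b → q :* a :- q :* b := q :* (a :- b)) refl q (seq x i) (seq x j)) ⟩
    ∣ q * d ∣                       ≡⟨ ℚₚ.∣p*q∣≡∣p∣*∣q∣ q d ⟩
    ∣ q ∣ * ∣ d ∣                   ≤⟨ ℚₚ.*-monoˡ-≤-nonNeg ∣ q ∣ (ℚₚ.<⇒≤ d<δ) ⟩
    ∣ q ∣ * δ                       ≡⟨ ℚₚ.+-identityˡ _ ⟨
    0ℚ + ∣ q ∣ * δ                  <⟨ ℚₚ.+-monoˡ-< (∣ q ∣ * δ) 0<δ ⟩
    δ + ∣ q ∣ * δ                   ≡⟨ solve 2 (λ a e → e :+ a :* e := (con 1ℚ :+ a) :* e) refl ∣ q ∣ δ ⟩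
    B * δ                           ≡⟨ Bδ≡ε ⟩
    ε                               ∎
    where
    open +-*-Solver
    d = seq x i - seq x j
    d<δ = proj₂ (cauchy x δ 0<δ) i j M≤i M≤j

∑< : ℕ → (ℕ → ℚ) → ℚ
∑< zero    f = 0ℚ
∑< (suc m) f = ∑< m f + f m

recip : ℕ → ℚ
recip n = + 1 / suc n

-- log N = ∫₁ᴺ dt / t.  With mesh 1 / k the right-endpoint Riemann sum is
--   ∑ { (1 / k) · 1 / (1 + (i + 1) / k) : i < k (N - 1) }
--     = ∑ { 1 / (k + i + 1) : i < k (N - 1) }.
riemann : ℕ → ℕ → ℚ
riemann N k = ∑< ((N ℕ.∸ 1) ℕ.* k) (λ i → recip (k ℕ.+ i))

module LogConvergence where
  toℚᵘ-recip : ∀ n → toℚᵘ (recip n) ℚᵘ.≃ ℚᵘ.mkℚᵘ (+ 1) n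
  toℚᵘ-recip n = ℚₚ.toℚᵘ-fromℚᵘ (ℚᵘ.mkℚᵘ (+ 1) n)

  recip-antimono-≤ : ∀ m n → m ℕ.≤ n → recip n ≤ recip m
  recip-antimono-≤ m n m≤n = ℚₚ.toℚᵘ-cancel-≤
    (ℚᵘₚ.≤-respʳ-≃ (ℚᵘₚ.≃-sym (toℚᵘ-recip m))
    (ℚᵘₚ.≤-respˡ-≃ (ℚᵘₚ.≃-sym (toℚᵘ-recip n))
    (ℚᵘ.*≤* (ℤₚ.*-monoˡ-≤-nonNeg (+ 1) (ℤ.+≤+ (ℕ.s≤s m≤n))))))

  recip-antimono-< : ∀ m n → m ℕ.< n → recip n < recip m
  recip-antimono-< m n m<n = ℚₚ.toℚᵘ-cancel-<
    (ℚᵘₚ.<-respʳ-≃ (ℚᵘₚ.≃-sym (toℚᵘ-recip m))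
    (ℚᵘₚ.<-respˡ-≃ (ℚᵘₚ.≃-sym (toℚᵘ-recip n))
    (ℚᵘ.*<* (ℤₚ.*-monoˡ-<-pos (+ 1) (ℤ.+<+ (ℕ.s≤s m<n))))))

  0<recip : ∀ n → 0ℚ < recip n
  0<recip n = ℚₚ.toℚᵘ-cancel-< (ℚᵘₚ.<-respʳ-≃ (ℚᵘₚ.≃-sym (toℚᵘ-recip n))
    (ℚᵘₚ.positive⁻¹ (ℚᵘ.mkℚᵘ (+ 1) n)))

  archimedean : ∀ ε → 0ℚ < ε → ∃[ d ] recip d ≤ ε
  archimedean (mkℚ (+ zero) _ _) 0<ε with () ← positive 0<ε
  archimedean (mkℚ (+ suc a) d _) _ = d , ℚₚ.toℚᵘ-cancel-≤
    (ℚᵘₚ.≤-respˡ-≃ (ℚᵘₚ.≃-sym (toℚᵘ-recip d))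
    (ℚᵘ.*≤* (ℤₚ.*-monoʳ-≤-nonNeg (+ suc d) {+ 1} {+ suc a} (ℤ.+≤+ (ℕ.s≤s ℕ.z≤n)))))
  archimedean (mkℚ (ℤ.-[1+ _ ]) _ _) 0<ε with () ← positive 0<ε

  ∑-mono : ∀ m {f g} → (∀ i → i ℕ.< m → f i ≤ g i) → ∑< m f ≤ ∑< m g
  ∑-mono zero    f≤g = ℚₚ.≤-refl
  ∑-mono (suc m) f≤g = ℚₚ.+-mono-≤
    (∑-mono m (λ i i<m → f≤g i (ℕₚ.m<n⇒m<1+n i<m))) (f≤g m ℕₚ.≤-refl)

  ∑-cong : ∀ m {f g} → (∀ i → f i ≡ g i) → ∑< m f ≡ ∑< m g
  ∑-cong zero    f≡g = refl
  ∑-cong (suc m) f≡g = cong₂ _+_ (∑-cong m f≡g) (f≡g m)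

  ∑-split : ∀ a b f → ∑< (a ℕ.+ b) f ≡ ∑< a f + ∑< b (λ i → f (a ℕ.+ i))
  ∑-split a zero    f rewrite ℕₚ.+-identityʳ a = sym (ℚₚ.+-identityʳ _)
  ∑-split a (suc b) f rewrite ℕₚ.+-suc a b | ∑-split a b f = ℚₚ.+-assoc (∑< a f) _ _

  ∑-blocks : ∀ m k f → ∑< (m ℕ.* k) f ≡ ∑< m (λ i → ∑< k (λ r → f (i ℕ.* k ℕ.+ r)))
  ∑-blocks zero    k f = refl
  ∑-blocks (suc m) k f rewrite ℕₚ.+-comm k (m ℕ.* k) | ∑-split (m ℕ.* k) k f
    | ∑-blocks m k f = refl

  ∑-shift : ∀ m a → ∑< m (λ i → recip (a ℕ.+ i)) ≤ ∑< m (λ i → recip (suc a ℕ.+ i)) + recip a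
  ∑-shift m a = begin
    ∑< m f                                   ≡⟨ ℚₚ.+-identityʳ _ ⟨
    ∑< m f + 0ℚ                              ≤⟨ ℚₚ.+-monoʳ-≤ (∑< m f) (ℚₚ.<⇒≤ (0<recip (a ℕ.+ m))) ⟩
    ∑< (1 ℕ.+ m) f                           ≡⟨ ∑-split 1 m f ⟩
    0ℚ + f 0 + ∑< m (λ i → f (1 ℕ.+ i))      ≡⟨ cong₂ _+_ (ℚₚ.+-identityˡ (f 0)) refl ⟩
    f 0 + ∑< m (λ i → f (1 ℕ.+ i))           ≡⟨ ℚₚ.+-comm (f 0) _ ⟩
    ∑< m (λ i → f (1 ℕ.+ i)) + f 0           ≡⟨ cong₂ _+_ (∑-cong m (λ i → cong recip (ℕₚ.+-suc a i))) (cong recip (ℕₚ.+-identityʳ a)) ⟩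
    ∑< m (λ i → recip (suc a ℕ.+ i)) + recip a ∎
    where
    open ℚₚ.≤-Reasoning
    f = λ i → recip (a ℕ.+ i)

  toℚᵘ-∑-recip : ∀ m n → toℚᵘ (∑< m (λ _ → recip n)) ℚᵘ.≃ ℚᵘ.mkℚᵘ (+ m) n
  toℚᵘ-∑-recip zero    n = ℚᵘ.*≡* refl
  toℚᵘ-∑-recip (suc m) n =
    ℚᵘₚ.≃-trans (ℚₚ.toℚᵘ-homo-+ (∑< m (λ _ → recip n)) (recip n))
    (ℚᵘₚ.≃-trans (ℚᵘₚ.+-cong (toℚᵘ-∑-recip m n) (toℚᵘ-recip n))
    (ℚᵘ.*≡* (solve 2 (λ m d → (m :* d :+ con (+ 1) :* d) :* d := (con (+ 1) :+ m) :* (d :* d))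
      refl (+ m) (+ suc n))))
    where open ℤSolver

  -- (k + 1) · 1 / ((k + 1) (a + 1)) = 1 / (a + 1)
  ∑-recip : ∀ k a → ∑< (suc k) (λ _ → recip (k ℕ.+ a ℕ.* suc k)) ≡ recip a
  ∑-recip k a = ℚₚ.toℚᵘ-injective (ℚᵘₚ.≃-trans (toℚᵘ-∑-recip (suc k) (k ℕ.+ a ℕ.* suc k))
    (ℚᵘₚ.≃-trans (ℚᵘ.*≡* eq) (ℚᵘₚ.≃-sym (toℚᵘ-recip a))))
    where
    eq : + suc k ℤ.* + suc a ≡ + 1 ℤ.* + (suc a ℕ.* suc k)
    eq = trans (ℤₚ.*-comm (+ suc k) (+ suc a))
      (trans (sym (ℤₚ.pos-* (suc a) (suc k))) (sym (ℤₚ.*-identityˡ _)))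

  block : ℕ → ℕ → ℚ
  block k a = ∑< (suc k) (λ r → recip (suc a ℕ.* suc k ℕ.+ r))

  block-lower : ∀ k a → recip (suc a) ≤ block k a
  block-lower k a = subst (_≤ block k a) (∑-recip k (suc a)) (∑-mono (suc k)
    λ { r (ℕ.s≤s r≤k) → recip-antimono-≤ (suc a ℕ.* suc k ℕ.+ r) (k ℕ.+ suc a ℕ.* suc k)
      (ℕₚ.≤-trans (ℕₚ.+-monoʳ-≤ (suc a ℕ.* suc k) r≤k)
        (ℕₚ.≤-reflexive (ℕₚ.+-comm (suc a ℕ.* suc k) k))) })

  block-upper : ∀ k a → block k a ≤ recip a
  block-upper k a = subst (block k a ≤_) (∑-recip k a) (∑-mono (suc k)
    λ r _ → recip-antimono-≤ (k ℕ.+ a ℕ.* suc k) (suc a ℕ.* suc k ℕ.+ r)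
      (ℕₚ.≤-trans (ℕₚ.n≤1+n _) (ℕₚ.m≤m+n _ r)))

  module _ (N : ℕ) where

    refine : ∀ j k → riemann N (suc j ℕ.* suc k) ≡ ∑< ((N ℕ.∸ 1) ℕ.* suc j) (λ i → block k (j ℕ.+ i))
    refine j k = trans
      (cong (λ m → ∑< m f) (sym (ℕₚ.*-assoc (N ℕ.∸ 1) (suc j) (suc k))))
      (trans (∑-blocks ((N ℕ.∸ 1) ℕ.* suc j) (suc k) f)
        (∑-cong ((N ℕ.∸ 1) ℕ.* suc j) λ i → ∑-cong (suc k) λ r → cong recip (index i r)))
      where
      f = λ i → recip (suc j ℕ.* suc k ℕ.+ i)
      index : ∀ i r → suc j ℕ.* suc k ℕ.+ (i ℕ.* suc k ℕ.+ r) ≡ suc (j ℕ.+ i) ℕ.* suc k ℕ.+ r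
      index i r = trans (sym (ℕₚ.+-assoc (suc j ℕ.* suc k) (i ℕ.* suc k) r))
        (cong (ℕ._+ r) (sym (ℕₚ.*-distribʳ-+ (suc k) (suc j) i)))

    refine-lower : ∀ j k → riemann N (suc j) ≤ riemann N (suc j ℕ.* suc k)
    refine-lower j k = subst (riemann N (suc j) ≤_) (sym (refine j k))
      (∑-mono ((N ℕ.∸ 1) ℕ.* suc j) λ i _ → block-lower k (j ℕ.+ i))

    refine-upper : ∀ j k → riemann N (suc j ℕ.* suc k) ≤ riemann N (suc j) + recip j
    refine-upper j k = subst (_≤ riemann N (suc j) + recip j) (sym (refine j k))
      (ℚₚ.≤-trans (∑-mono ((N ℕ.∸ 1) ℕ.* suc j) λ i _ → block-upper k (j ℕ.+ i)) (∑-shift ((N ℕ.∸ 1) ℕ.* suc j) j))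

    riemann-≤ : ∀ j k → riemann N (suc j) - riemann N (suc k) ≤ recip k
    riemann-≤ j k = begin
      riemann N (suc j) - y            ≤⟨ ℚₚ.+-monoˡ-≤ (- y) (refine-lower j k) ⟩
      riemann N (suc j ℕ.* suc k) - y  ≡⟨ cong (λ m → riemann N m - y) (ℕₚ.*-comm (suc j) (suc k)) ⟩
      riemann N (suc k ℕ.* suc j) - y  ≤⟨ ℚₚ.+-monoˡ-≤ (- y) (refine-upper k j) ⟩
      y + recip k - y                  ≡⟨ solve 2 (λ y r → y :+ r :- y := r) refl y (recip k) ⟩
      recip k                          ∎
      where
      open ℚₚ.≤-Reasoning
      open +-*-Solver
      y = riemann N (suc k)

open LogConvergence

log : (N : ℕ) .{{_ : ℕ.NonZero N}} → ℝ
log N .seq k = riemann N (suc k)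
log N .cauchy ε 0<ε with d , recip-d≤ε ← archimedean ε 0<ε = suc d , bound
  where
  small : ∀ i j → d ℕ.< i → riemann N (suc j) - riemann N (suc i) < ε
  small i j d<i = ℚₚ.≤-<-trans (riemann-≤ N j i) (ℚₚ.<-≤-trans (recip-antimono-< d i d<i) recip-d≤ε)
  bound : ∀ i j → d ℕ.< i → d ℕ.< j → ∣ riemann N (suc i) - riemann N (suc j) ∣ < ε
  bound i j d<i d<j with ℚₚ.∣p∣≡p∨∣p∣≡-p (riemann N (suc i) - riemann N (suc j))
  ... | inj₁ eq = subst (_< ε) (sym eq) (small j i d<j)
  ... | inj₂ eq = subst (_< ε)
    (sym (trans eq (solve 2 (λ x y → :- (x :- y) := y :- x) refl (riemann N (suc i)) (riemann N (suc j)))))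
    (small i j d<i)
    where open +-*-Solver

{-# OPTIONS --safe #-}

-- Write N = |n| and let S ⊆ [1, N²] have m elements and property D(n).  For an odd prime p ∤ n, let A be the
-- set of k nonzero residues of S mod p.  As ab + n is a square mod p for distinct a, b ∈ A, counting the points
-- (x, y) with y² = ax + n, a ∈ A, above x ∈ A and comparing with the variance over all x gives
-- (k − 3)² ≤ 2k + p; here two such parabolas have at most p + 2 pairs of points above a common x, because these
-- pairs form a conic, which is projected from one of its points.  Hence S meets at most i + 5 classes mod p if
-- p ≤ i² and i ≥ 4.
--
-- By the pigeonhole principle p^(m − i − 5) then divides V = ∏ |a − b|, the product over pairs from S, and
-- V ≤ N^(m(m − 1)).  Rearranging the product of these prime powers, ∏_{4 ≤ i ≤ m − 6} ∏_{p ≤ i², p ∤ 2n} p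
-- divides V.  Chebyshev's lower bound for the inner products yields 2^X ≤ N^(16 m²) 2^Y where X and Y are the
-- sums of 16 i² and 32 + (131 + i) i over these i, so 16 m² log N ≥ (X − Y) log 2 with X − Y ~ 5 m³.  Together
-- with log 2 > 37/60 this bounds m by a multiple of log N that is smaller than the required one unless m is
-- small, and then N > 400 or N ≥ 10^100 suffices.
module Submission where

open import Defs

-- Finite sums over lists and counting by injections.

module Counting where

  open import Data.List using (List; []; _∷_; _++_; length; filter; cartesianProduct; map)
  open import Data.List.Membership.Propositional using (_∈_)
  open import Data.List.Membership.Propositional.Properties using (∈-∃++; ∈-++⁻; ∈-++⁺ˡ; ∈-++⁺ʳ; ∈-filter⁺; ∈-filter⁻)
  open import Data.List.Properties using (length-++)
  open import Data.List.Relation.Unary.All as All using (All)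
  open import Data.List.Relation.Unary.AllPairs using ([]; _∷_)
  open import Data.List.Relation.Unary.Any using (here; there)
  open import Data.List.Relation.Unary.Unique.Propositional using (Unique)
  import Data.List.Relation.Unary.Unique.Propositional.Properties as Uniqueₚ
  open import Data.Nat using (ℕ; suc; _+_; _*_; _≤_; z≤n; s≤s)
  import Data.Nat.Properties as ℕₚ
  open import Data.Nat.Tactic.RingSolver using (solve-∀)
  open import Data.Product using (_×_; _,_; ∃-syntax)
  open import Data.Sum using (inj₁; inj₂)
  open import Data.Unit using (⊤; tt)
  open import Function using (_∘_)
  open import Relation.Binary.PropositionalEquality
  open import Relation.Nullary using (Dec; yes; no; contradiction; _×-dec_)
  open import Relation.Unary using (Decidable)

  private variable
    A B : Set
    P Q : Set

  ∑ : List A → (A → ℕ) → ℕ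
  ∑ []       f = 0
  ∑ (x ∷ xs) f = f x + ∑ xs f

  𝟙 : Dec P → ℕ
  𝟙 (yes _) = 1
  𝟙 (no  _) = 0

  𝟙-× : (P? : Dec P) (Q? : Dec Q) → 𝟙 P? * 𝟙 Q? ≡ 𝟙 (P? ×-dec Q?)
  𝟙-× (yes _) (yes _) = refl
  𝟙-× (yes _) (no  _) = refl
  𝟙-× (no  _) _       = refl

  ∑-mono : ∀ (xs : List A) {f g} → (∀ {x} → x ∈ xs → f x ≤ g x) → ∑ xs f ≤ ∑ xs g
  ∑-mono []       f≤g = z≤n
  ∑-mono (x ∷ xs) f≤g = ℕₚ.+-mono-≤ (f≤g (here refl)) (∑-mono xs (f≤g ∘ there))

  ∑-cong : ∀ (xs : List A) {f g} → (∀ x → f x ≡ g x) → ∑ xs f ≡ ∑ xs g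
  ∑-cong []       f≡g = refl
  ∑-cong (x ∷ xs) f≡g = cong₂ _+_ (f≡g x) (∑-cong xs f≡g)

  ∑-const : ∀ (xs : List A) c → ∑ xs (λ _ → c) ≡ length xs * c
  ∑-const []       c = refl
  ∑-const (x ∷ xs) c = cong (c +_) (∑-const xs c)

  ∑-+ : ∀ (xs : List A) f g → ∑ xs (λ x → f x + g x) ≡ ∑ xs f + ∑ xs g
  ∑-+ []       f g = refl
  ∑-+ (x ∷ xs) f g = trans (cong (f x + g x +_) (∑-+ xs f g)) (lemma (f x) (g x) (∑ xs f) (∑ xs g))
    where
    lemma : ∀ a b c d → a + b + (c + d) ≡ a + c + (b + d)
    lemma = solve-∀

  ∑-*ˡ : ∀ (xs : List A) c f → ∑ xs (λ x → c * f x) ≡ c * ∑ xs f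
  ∑-*ˡ []       c f = sym (ℕₚ.*-zeroʳ c)
  ∑-*ˡ (x ∷ xs) c f = trans (cong (c * f x +_) (∑-*ˡ xs c f)) (sym (ℕₚ.*-distribˡ-+ c (f x) (∑ xs f)))

  ∑-*ʳ : ∀ (xs : List A) c f → ∑ xs (λ x → f x * c) ≡ ∑ xs f * c
  ∑-*ʳ xs c f = trans (∑-cong xs (λ x → ℕₚ.*-comm (f x) c)) (trans (∑-*ˡ xs c f) (ℕₚ.*-comm c (∑ xs f)))

  ∑-swap : ∀ (xs : List A) (ys : List B) (f : A → B → ℕ) → ∑ xs (λ x → ∑ ys (f x)) ≡ ∑ ys (λ y → ∑ xs (λ x → f x y))
  ∑-swap []       ys f = sym (trans (∑-const ys 0) (ℕₚ.*-zeroʳ (length ys)))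
  ∑-swap (x ∷ xs) ys f = trans (cong (∑ ys (f x) +_) (∑-swap xs ys f)) (sym (∑-+ ys (f x) _))

  ∑-++ : ∀ (xs ys : List A) f → ∑ (xs ++ ys) f ≡ ∑ xs f + ∑ ys f
  ∑-++ []       ys f = refl
  ∑-++ (x ∷ xs) ys f = trans (cong (f x +_) (∑-++ xs ys f)) (sym (ℕₚ.+-assoc (f x) _ _))

  ∑-map : ∀ (xs : List A) (h : A → B) f → ∑ (map h xs) f ≡ ∑ xs (f ∘ h)
  ∑-map []       h f = refl
  ∑-map (x ∷ xs) h f = cong (f (h x) +_) (∑-map xs h f)

  ∑-product : ∀ (xs : List A) (ys : List B) f →
              ∑ (cartesianProduct xs ys) f ≡ ∑ xs (λ x → ∑ ys (λ y → f (x , y)))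
  ∑-product []       ys f = refl
  ∑-product (x ∷ xs) ys f = trans (∑-++ (map (x ,_) ys) _ f)
    (cong₂ _+_ (∑-map ys (x ,_) f) (∑-product xs ys f))

  ∑*∑ : ∀ (xs : List A) (ys : List B) f g →
        ∑ xs f * ∑ ys g ≡ ∑ xs (λ x → ∑ ys (λ y → f x * g y))
  ∑*∑ xs ys f g = trans (sym (∑-*ʳ xs (∑ ys g) f)) (∑-cong xs (λ x → sym (∑-*ˡ ys (f x) g)))

  ∑-𝟙 : ∀ {P : A → Set} (P? : Decidable P) xs → ∑ xs (𝟙 ∘ P?) ≡ length (filter P? xs)
  ∑-𝟙 P? [] = refl
  ∑-𝟙 P? (x ∷ xs) with P? x
  ... | yes _ = cong suc (∑-𝟙 P? xs)
  ... | no  _ = ∑-𝟙 P? xs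

  -- A relation stands in for the injection, so partners may be chosen existentially. Each step
  -- deletes the partner `y` of the head from `ys`; injectivity keeps the partners of the tail away
  -- from that occurrence.
  length-injection : ∀ {xs : List A} (ys : List B) → Unique xs → (R : A → B → Set) →
    (∀ {x} → x ∈ xs → ∃[ y ] y ∈ ys × R x y) →
    (∀ {x x′ y} → x ∈ xs → x′ ∈ xs → R x y → R x′ y → x ≡ x′) →
    length xs ≤ length ys
  length-injection ys [] R total inj = z≤n
  length-injection {xs = x ∷ xs} ys (x∉ ∷ uniq) R total inj
    with y , y∈ , Rxy ← total (here refl)
    with us , vs , refl ← ∈-∃++ y∈ = begin
      suc (length xs)              ≤⟨ s≤s (length-injection (us ++ vs) uniq R total′ (λ p q → inj (there p) (there q))) ⟩
      suc (length (us ++ vs))      ≡⟨ cong suc (length-++ us) ⟩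
      suc (length us + length vs)  ≡⟨ ℕₚ.+-suc (length us) (length vs) ⟨
      length us + suc (length vs)  ≡⟨ length-++ us ⟨
      length (us ++ y ∷ vs)        ∎
    where
    open ℕₚ.≤-Reasoning
    total′ : ∀ {x′} → x′ ∈ xs → ∃[ y′ ] y′ ∈ us ++ vs × R x′ y′
    total′ x′∈ with y′ , y′∈ , Rx′y′ ← total (there x′∈) with ∈-++⁻ us y′∈
    ... | inj₁ y′∈us         = y′ , ∈-++⁺ˡ y′∈us , Rx′y′
    ... | inj₂ (there y′∈vs) = y′ , ∈-++⁺ʳ us y′∈vs , Rx′y′
    ... | inj₂ (here refl)   = contradiction (inj (here refl) (there x′∈) Rxy Rx′y′) (All.lookup x∉ x′∈)

  count-≤ : ∀ {xs : List A} {P : A → Set} (P? : Decidable P) (ys : List B) → Unique xs →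
    (R : A → B → Set) →
    (∀ {x} → x ∈ xs → P x → ∃[ y ] y ∈ ys × R x y) →
    (∀ {x x′ y} → x ∈ xs → x′ ∈ xs → P x → P x′ → R x y → R x′ y → x ≡ x′) →
    ∑ xs (𝟙 ∘ P?) ≤ length ys
  count-≤ {xs = xs} P? ys uniq R total inj = subst (_≤ length ys) (sym (∑-𝟙 P? xs))
    (length-injection ys (Uniqueₚ.filter⁺ P? uniq) R
      (λ x∈ → let x∈xs , Px = ∈-filter⁻ P? x∈ in total x∈xs Px)
      (λ x∈ x′∈ → let x∈xs , Px = ∈-filter⁻ P? x∈ ; x′∈xs , Px′ = ∈-filter⁻ P? x′∈ in inj x∈xs x′∈xs Px Px′))

  count-≥ : ∀ (xs : List A) {ys : List B} {P : A → Set} (P? : Decidable P) → Unique ys →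
    (R : B → A → Set) →
    (∀ {y} → y ∈ ys → ∃[ x ] x ∈ xs × P x × R y x) →
    (∀ {y y′ x} → y ∈ ys → y′ ∈ ys → R y x → R y′ x → y ≡ y′) →
    length ys ≤ ∑ xs (𝟙 ∘ P?)
  count-≥ xs P? uniq R total inj = subst (_ ≤_) (sym (∑-𝟙 P? xs))
    (length-injection (filter P? xs) uniq R
      (λ y∈ → let x , x∈ , Px , Ryx = total y∈ in x , ∈-filter⁺ P? x∈ Px , Ryx) inj)

  count-unique : ∀ {xs : List A} {P : A → Set} (P? : Decidable P) → Unique xs →
    (∀ {x x′} → x ∈ xs → x′ ∈ xs → P x → P x′ → x ≡ x′) → ∑ xs (𝟙 ∘ P?) ≤ 1
  count-unique P? uniq inj = count-≤ P? (0 ∷ []) uniq (λ _ _ → ⊤) (λ _ _ → 0 , here refl , tt)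
    (λ x∈ x′∈ Px Px′ _ _ → inj x∈ x′∈ Px Px′)

-- Arithmetic modulo a prime, parabolas and conics.

module ModularArithmetic where

  open import Data.Integer as ℤ using (ℤ; +_; -_; _+_; _*_; _-_)
  open import Data.Integer.Divisibility.Signed using (_∣_; divides; ∣⇒∣ᵤ; ∣ᵤ⇒∣; ∣m∣n⇒∣m+n; ∣n⇒∣m*n)
  import Data.Integer.DivMod as ℤDM
  import Data.Integer.Properties as ℤₚ
  open import Data.Integer.Tactic.RingSolver using () renaming (solve-∀ to ℤ-solve)
  open import Data.Nat as ℕ using (ℕ; zero; suc; _<_)
  import Data.Nat.Properties as ℕₚ
  import Data.Nat.Divisibility as ℕD
  open import Data.Nat.Coprimality using (coprime-Bézout; prime⇒coprime)
  open import Data.Nat.GCD using (module Bézout)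
  open import Data.Nat.Primality using (Prime; euclidsLemma; prime⇒nonZero)
  open import Data.Product using (_×_; _,_; ∃-syntax)
  open import Data.Sum using (_⊎_; inj₁; inj₂; [_,_]′)
  open import Relation.Binary.PropositionalEquality
  open import Relation.Nullary using (¬_; contradiction)

  module Residues (p : ℕ) (p-prime : Prime p) where


    private instance
      p≢0 : ℕ.NonZero p
      p≢0 = prime⇒nonZero p-prime

    Div : ℤ → Set
    Div x = + p ∣ x

    -- Congruences are proved by certificates: the target is written as a combination of known
    -- multiples of `p`, and the ring solver verifies the identity.
    lin₁ : ∀ α {u w} → Div u → w ≡ α * u → Div w
    lin₁ α d refl = ∣n⇒∣m*n α d

    lin₂ : ∀ α β {u v w} → Div u → Div v → w ≡ α * u + β * v → Div w
    lin₂ α β d e refl = ∣m∣n⇒∣m+n (∣n⇒∣m*n α d) (∣n⇒∣m*n β e)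

    lin₃ : ∀ α β γ {u v w x} → Div u → Div v → Div w → x ≡ α * u + β * v + γ * w → Div x
    lin₃ α β γ d e f refl = ∣m∣n⇒∣m+n (lin₂ α β d e refl) (∣n⇒∣m*n γ f)

    euclid : ∀ x y → Div (x * y) → Div x ⊎ Div y
    euclid x y d with euclidsLemma ℤ.∣ x ∣ ℤ.∣ y ∣ p-prime (subst (p ℕD.∣_) (ℤₚ.abs-* x y) (∣⇒∣ᵤ d))
    ... | inj₁ h = inj₁ (∣ᵤ⇒∣ h)
    ... | inj₂ h = inj₂ (∣ᵤ⇒∣ h)

    cancel : ∀ {x} y → ¬ Div x → Div (x * y) → Div y
    cancel {x} y ¬d d with euclid x y d
    ... | inj₁ h = contradiction h ¬d
    ... | inj₂ h = h

    -- The difference is smaller than `p` in absolute value, and 0 is the only such multiple of `p`.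
    ≡-of-small : ∀ {x y} → x < p → y < p → Div (+ x - + y) → x ≡ y
    ≡-of-small {x} {y} x<p y<p d = ℤₚ.+-injective (ℤₚ.i-j≡0⇒i≡j (+ x) (+ y) (ℤₚ.∣i∣≡0⇒i≡0 (≡0 _ refl)))
      where
      small : ℤ.∣ + x - + y ∣ < p
      small = subst (λ z → ℤ.∣ z ∣ < p) (sym (ℤₚ.m-n≡m⊖n x y))
        (ℕₚ.≤-<-trans (ℤₚ.∣m⊝n∣≤m⊔n x y) (ℕₚ.⊔-lub x<p y<p))
      ≡0 : ∀ k → ℤ.∣ + x - + y ∣ ≡ k → ℤ.∣ + x - + y ∣ ≡ 0
      ≡0 zero    eq = eq
      ≡0 (suc k) eq = contradiction small (ℕₚ.≤⇒≯ (ℕD.∣⇒≤ {{ℕ.≢-nonZero λ z → ℕₚ.1+n≢0 (trans (sym eq) z)}} (∣⇒∣ᵤ d)))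

    residue : ∀ c → ∃[ r ] r < p × Div (c - + r)
    residue c = c ℤDM.%ℕ p , ℤDM.n%ℕd<d c p , divides (c ℤDM./ℕ p)
      (trans (cong (_- + (c ℤDM.%ℕ p)) (ℤDM.a≡a%ℕn+[a/ℕn]*n c p)) (lemma (+ (c ℤDM.%ℕ p)) ((c ℤDM./ℕ p) * + p)))
      where
      lemma : ∀ x y → x + y - x ≡ y
      lemma = ℤ-solve

    private
      bézout : ∀ r .{{_ : ℕ.NonZero r}} → r < p → ∃[ u ] Div (+ r * u - + 1)
      bézout r r<p with coprime-Bézout (prime⇒coprime p-prime r<p)
      -- Here Bézout reads 1 + y r = x p, so -y inverts r; in the other case it reads 1 + x p = y r,
      -- and y does.
      ... | Bézout.+- x y eq = - (+ y) , divides (- (+ x)) (trans (lemma (+ r) (+ y)) (trans (cong -_ cast) (ℤₚ.neg-distribˡ-* (+ x) (+ p))))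
        where
        lemma : ∀ r y → r * - y - + 1 ≡ - (+ 1 + y * r)
        lemma = ℤ-solve
        cast : + 1 + + y * + r ≡ + x * + p
        cast = trans (cong (λ z → + 1 + z) (sym (ℤₚ.pos-* y r))) (trans (cong +_ eq) (ℤₚ.pos-* x p))
      ... | Bézout.-+ x y eq = + y , divides (+ x) (trans (cong (_- + 1) (ℤₚ.*-comm (+ r) (+ y)))
        (trans (cong (_- + 1) (sym cast)) (lemma (+ x * + p))))
        where
        lemma : ∀ z → + 1 + z - + 1 ≡ z
        lemma = ℤ-solve
        cast : + 1 + + x * + p ≡ + y * + r
        cast = trans (cong (λ z → + 1 + z) (sym (ℤₚ.pos-* x p))) (trans (cong +_ eq) (ℤₚ.pos-* y r))

    divide : ∀ a c → ¬ Div a → ∃[ x ] x < p × Div (a * + x - c)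
    divide a c ¬Da with residue a
    ... | zero  , _   , d = contradiction (lin₁ (+ 1) d (lemma a)) ¬Da
      where
      lemma : ∀ a → a ≡ + 1 * (a - + 0)
      lemma = ℤ-solve
    ... | suc r , r<p , d with bézout (suc r) r<p
    ...   | u , e with residue (u * c)
    ...     | x , x<p , f = x , x<p , lin₃ (u * c) c (- a) d e f (lemma a c u (+ suc r) (+ x))
      where
      lemma : ∀ a c u r x → a * x - c ≡ u * c * (a - r) + c * (r * u - + 1) + - a * (u * c - x)
      lemma = ℤ-solve

    -- A record rather than a bare `Div`, so that coefficients and coordinates can be recovered by
    -- unification.
    record OnParabola (n a x y : ℤ) : Set where
      constructor onParabola
      field equation : Div (y * y - (a * x + n))

    record OnConic (n a b y z : ℤ) : Set where
      constructor onConic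
      field equation : Div (b * (y * y - n) - a * (z * z - n))

    parabola-x-unique : ∀ {n a x x′ y} → ¬ Div a → OnParabola n a x y → OnParabola n a x′ y → Div (x - x′)
    parabola-x-unique {n} {a} {x} {x′} {y} ¬a (onParabola d) (onParabola e) =
      cancel (x - x′) ¬a (lin₂ (- + 1) (+ 1) d e (lemma n a x x′ y))
      where
      lemma : ∀ n a x x′ y → a * (x - x′) ≡ - + 1 * (y * y - (a * x + n)) + + 1 * (y * y - (a * x′ + n))
      lemma = ℤ-solve

    parabola-y-± : ∀ {n a x y z} → OnParabola n a x y → OnParabola n a x z → Div (z - y) ⊎ Div (z + y)
    parabola-y-± {n} {a} {x} {y} {z} (onParabola d) (onParabola e) = euclid _ _ (lin₂ (+ 1) (- + 1) e d (lemma n a x y z))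
      where
      lemma : ∀ n a x y z → (z - y) * (z + y) ≡ + 1 * (z * z - (a * x + n)) + - + 1 * (y * y - (a * x + n))
      lemma = ℤ-solve

    -- Eliminates x: both b (y² - n) and a (z² - n) are congruent to a b x.
    parabolas⇒conic : ∀ {n a b x y z} → OnParabola n a x y → OnParabola n b x z → OnConic n a b y z
    parabolas⇒conic {n} {a} {b} {x} {y} {z} (onParabola d) (onParabola e) = onConic (lin₂ b (- a) d e (lemma n a b x y z))
      where
      lemma : ∀ n a b x y z → b * (y * y - n) - a * (z * z - n) ≡ b * (y * y - (a * x + n)) + - a * (z * z - (b * x + n))
      lemma = ℤ-solve

    module Conic (n a b y₀ z₀ : ℤ) (¬2 : ¬ Div (+ 2)) (¬n : ¬ Div n) (¬a : ¬ Div a) (¬b : ¬ Div b)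
                 (a≢b : ¬ Div (a - b)) (base-on : OnConic n a b y₀ z₀) where

      private base = OnConic.equation base-on

      -- For z ≡ z₀ the difference of the two conic equations reduces to b (y² - y₀²) ≡ 0.
      y-± : ∀ {y z} → OnConic n a b y z → Div (z - z₀) → Div (y - y₀) ⊎ Div (y + y₀)
      y-± {y} {z} (onConic d) e = euclid _ _ (cancel _ ¬b (lin₃ (+ 1) (- + 1) (a * (z + z₀)) d base e (lemma n a b y₀ z₀ y z)))
        where
        lemma : ∀ n a b y₀ z₀ y z → b * ((y - y₀) * (y + y₀)) ≡
          + 1 * (b * (y * y - n) - a * (z * z - n)) + - + 1 * (b * (y₀ * y₀ - n) - a * (z₀ * z₀ - n))
          + a * (z + z₀) * (z - z₀)
        lemma = ℤ-solve

      -- Substituting y = y₀ + t (z − z₀) into the difference of two conic equations and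
      -- cancelling z − z₀ leaves a linear equation for z.
      on-line : ∀ t y z → OnConic n a b y z → ¬ Div (z - z₀) → Div (y - y₀ - t * (z - z₀)) →
                Div ((b * t * t - a) * (z - z₀) - + 2 * (a * z₀ - b * t * y₀))
      on-line t y z (onConic d) ¬z e = cancel _ ¬z
        (lin₃ (+ 1) (- + 1) (- (b * (y + y₀ + t * (z - z₀)))) d base e (lemma n a b y₀ z₀ t y z))
        where
        lemma : ∀ n a b y₀ z₀ t y z →
          (z - z₀) * ((b * t * t - a) * (z - z₀) - + 2 * (a * z₀ - b * t * y₀)) ≡
          + 1 * (b * (y * y - n) - a * (z * z - n)) + - + 1 * (b * (y₀ * y₀ - n) - a * (z₀ * z₀ - n))
          + - (b * (y + y₀ + t * (z - z₀))) * (y - y₀ - t * (z - z₀))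
        lemma = ℤ-solve

      -- Were b t² ≡ a, the linear equation would leave 2 (a z₀ - b t y₀) ≡ 0, hence y₀ ≡ t z₀. The
      -- conic equation of the base point then becomes n (a - b) ≡ 0, which is excluded.
      not-asymptote : ∀ t z → Div ((b * t * t - a) * (z - z₀) - + 2 * (a * z₀ - b * t * y₀)) → ¬ Div (b * t * t - a)
      not-asymptote t z d e = [ ¬n , a≢b ]′
        (euclid n (a - b) (lin₃ (+ 1) (- (b * (y₀ + t * z₀))) (- (z₀ * z₀)) base y₀≈tz₀ e (lemma₃ n a b y₀ z₀ t)))
        where
        lemma₁ : ∀ a b y₀ z₀ t z → + 2 * (a * z₀ - b * t * y₀) ≡
          - + 1 * ((b * t * t - a) * (z - z₀) - + 2 * (a * z₀ - b * t * y₀)) + (z - z₀) * (b * t * t - a)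
        lemma₁ = ℤ-solve
        lemma₂ : ∀ a b y₀ z₀ t → a * (y₀ - t * z₀) ≡ - t * (a * z₀ - b * t * y₀) + - y₀ * (b * t * t - a)
        lemma₂ = ℤ-solve
        lemma₃ : ∀ n a b y₀ z₀ t → n * (a - b) ≡ + 1 * (b * (y₀ * y₀ - n) - a * (z₀ * z₀ - n))
          + - (b * (y₀ + t * z₀)) * (y₀ - t * z₀) + - (z₀ * z₀) * (b * t * t - a)
        lemma₃ = ℤ-solve
        y₀≈tz₀ : Div (y₀ - t * z₀)
        y₀≈tz₀ = cancel _ ¬a (lin₂ (- t) (- y₀) (cancel _ ¬2 (lin₂ (- + 1) (z - z₀) d e (lemma₁ a b y₀ z₀ t z))) e (lemma₂ a b y₀ z₀ t))

      -- By `on-line` and `not-asymptote`, z solves a linear congruence with invertible leading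
      -- coefficient that depends only on the slope and the base point; the line then determines y.
      slope-injective : ∀ t {y z y′ z′} → OnConic n a b y z → OnConic n a b y′ z′ →
        ¬ Div (z - z₀) → ¬ Div (z′ - z₀) → Div (y - y₀ - t * (z - z₀)) → Div (y′ - y₀ - t * (z′ - z₀)) →
        Div (y - y′) × Div (z - z′)
      slope-injective t {y} {z} {y′} {z′} d d′ ¬z ¬z′ e e′ =
        lin₃ (+ 1) (- + 1) t e e′ z≈z′ (lemma₂ y₀ z₀ t y z y′ z′) , z≈z′
        where
        lemma₁ : ∀ c k z z′ z₀ → c * (z - z′) ≡ + 1 * (c * (z - z₀) - k) + - + 1 * (c * (z′ - z₀) - k)
        lemma₁ = ℤ-solve
        lemma₂ : ∀ y₀ z₀ t y z y′ z′ → y - y′ ≡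
          + 1 * (y - y₀ - t * (z - z₀)) + - + 1 * (y′ - y₀ - t * (z′ - z₀)) + t * (z - z′)
        lemma₂ = ℤ-solve
        line = on-line t y z d ¬z e
        line′ = on-line t y′ z′ d′ ¬z′ e′
        z≈z′ : Div (z - z′)
        z≈z′ = cancel _ (not-asymptote t z line) (lin₂ (+ 1) (- + 1) line line′
          (lemma₁ (b * t * t - a) (+ 2 * (a * z₀ - b * t * y₀)) z z′ z₀))

-- Cliques modulo a prime: the second-moment bound.

module CliqueBound where

  open Counting
  open ModularArithmetic
  open import Data.Integer as ℤ using (ℤ; +_; -_)
  open import Data.Integer.Divisibility.Signed using (_∣?_; divides)
  import Data.Integer.Properties as ℤₚ
  open import Data.Integer.Tactic.RingSolver using () renaming (solve-∀ to ℤ-solve)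
  open import Data.List using (List; []; _∷_; length; upTo; cartesianProduct; map; _++_)
  open import Data.List.Membership.Propositional using (_∈_; find; lose)
  open import Data.List.Membership.Propositional.Properties
    using (∈-upTo⁺; ∈-upTo⁻; ∈-map⁺; ∈-++⁺ˡ; ∈-++⁺ʳ; ∈-cartesianProduct⁺; ∈-cartesianProduct⁻)
  open import Data.List.Properties using (length-upTo; length-map; length-++)
  open import Data.List.Relation.Unary.All using ([]; _∷_)
  open import Data.List.Relation.Unary.AllPairs using ([]; _∷_)
  open import Data.List.Relation.Unary.Any using (Any; here; there; any?)
  open import Data.List.Relation.Unary.Unique.Propositional using (Unique)
  import Data.List.Relation.Unary.Unique.Propositional.Properties as Uniqueₚ
  open import Data.Nat using (ℕ; suc; >-nonZero; _+_; _*_; _<_; _≤_; _≟_; z≤n; s≤s)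
  import Data.Nat.Properties as ℕₚ
  open import Data.List.Membership.DecPropositional ℕₚ._≟_ using (_∈?_)
  open import Data.Nat.Primality using (Prime)
  open import Data.Nat.Tactic.RingSolver using (solve-∀)
  open import Data.Product using (_×_; _,_; ∃-syntax; proj₁; proj₂)
  open import Data.Sum using (_⊎_; inj₁; inj₂; [_,_]′)
  open import Data.Empty using (⊥)
  open import Function using (_∘_)
  open import Relation.Binary.PropositionalEquality
  open import Relation.Nullary using (Dec; yes; no; ¬_; contradiction; _×-dec_)
  open import Relation.Nullary.Decidable using (map′)
  open import Relation.Unary using (Decidable)

  2ab≤a²+b² : ∀ a b → 2 * b * a ≤ a * a + b * b
  2ab≤a²+b² a b with ℕₚ.≤-total a b
  ... | inj₁ a≤b with d , refl ← ℕₚ.m≤n⇒∃[o]m+o≡n a≤b =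
    ℕₚ.≤-trans (ℕₚ.m≤m+n _ (d * d)) (ℕₚ.≤-reflexive (lemma a d))
    where
    lemma : ∀ a d → 2 * (a + d) * a + d * d ≡ a * a + (a + d) * (a + d)
    lemma = solve-∀
  ... | inj₂ b≤a with d , refl ← ℕₚ.m≤n⇒∃[o]m+o≡n b≤a =
    ℕₚ.≤-trans (ℕₚ.m≤m+n _ (d * d)) (ℕₚ.≤-reflexive (lemma b d))
    where
    lemma : ∀ b d → 2 * b * (b + d) + d * d ≡ (b + d) * (b + d) + b * b
    lemma = solve-∀

  module Modulo (p : ℕ) (p-prime : Prime p) where

    open Residues p p-prime

    module Clique
      (¬2 : ¬ Div (+ 2)) (n : ℤ) (¬n : ¬ Div n)
      (A : List ℕ) (A-unique : Unique A) (A<p : ∀ {a} → a ∈ A → a < p) (A≢0 : ∀ {a} → a ∈ A → ¬ Div (+ a))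
      (square : ∀ {a b} → a ∈ A → b ∈ A → a ≢ b → ∃[ y ] y < p × OnParabola n (+ a) (+ b) (+ y))
      where

      private
        X = upTo p
        X-unique = Uniqueₚ.upTo⁺ p
        X² = cartesianProduct X X
        X³ = cartesianProduct X X²
        X³-unique = Uniqueₚ.cartesianProduct⁺ X-unique (Uniqueₚ.cartesianProduct⁺ X-unique X-unique)
        k = length A

        ≡-of-X : ∀ {x y} → x ∈ X → y ∈ X → Div (+ x ℤ.- + y) → x ≡ y
        ≡-of-X x∈ y∈ = ≡-of-small (∈-upTo⁻ x∈) (∈-upTo⁻ y∈)

      root? : ∀ a x y → Dec (OnParabola n (+ a) (+ x) (+ y))
      root? a x y = map′ onParabola OnParabola.equation (+ p ∣? _)

      -- This is 1 plus the Legendre symbol of a x + n. Working with root counts turns character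
      -- sums into point counts on curves.
      roots : ℕ → ℕ → ℕ
      roots a x = ∑ X (𝟙 ∘ root? a x)

      allRoots : ℕ → ℕ
      allRoots x = ∑ A (λ a → roots a x)

      -- As a is invertible, the parabola is a graph over y: each y has its x.
      ∑-roots : ∀ a → a ∈ A → p ≤ ∑ X (roots a)
      ∑-roots a a∈ = subst₂ _≤_ (length-upTo p) (∑-product X X _)
        (count-≥ X² (λ xy → root? a (proj₁ xy) (proj₂ xy)) X-unique (λ y xy → y ≡ proj₂ xy)
          (λ {y} y∈ → let x , x<p , d = divide (+ a) (+ y ℤ.* + y ℤ.- n) (A≢0 a∈) in
            (x , y) , ∈-cartesianProduct⁺ (∈-upTo⁺ x<p) y∈ , onParabola (lin₁ (- + 1) d (lemma n (+ a) (+ x) (+ y))) , refl)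
          λ _ _ eq eq′ → trans eq (sym eq′))
        where
        lemma : ∀ n a x y → y ℤ.* y ℤ.- (a ℤ.* x ℤ.+ n) ≡ - + 1 ℤ.* (a ℤ.* x ℤ.- (y ℤ.* y ℤ.- n))
        lemma = ℤ-solve

      ∑-allRoots : k * p ≤ ∑ X allRoots
      ∑-allRoots = begin
        k * p                    ≡⟨ ∑-const A p ⟨
        ∑ A (λ _ → p)            ≤⟨ ∑-mono A (λ {a} → ∑-roots a) ⟩
        ∑ A (λ a → ∑ X (roots a)) ≡⟨ ∑-swap A X roots ⟩
        ∑ X allRoots             ∎
        where open ℕₚ.≤-Reasoning

      Common : ℕ → ℕ → ℕ × ℕ × ℕ → Set
      Common a b (x , y , z) = OnParabola n (+ a) (+ x) (+ y) × OnParabola n (+ b) (+ x) (+ z)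

      common? : ∀ a b → Decidable (Common a b)
      common? a b (x , y , z) = root? a x y ×-dec root? b x z

      roots² : ∀ a b → ∑ X (λ x → roots a x * roots b x) ≡ ∑ X³ (𝟙 ∘ common? a b)
      roots² a b = trans (∑-cong X λ x → trans (∑*∑ X X _ _)
          (trans (∑-cong X λ y → ∑-cong X λ z → 𝟙-× (root? a x y) (root? b x z))
            (sym (∑-product X X λ yz → 𝟙 (common? a b (x , yz))))))
        (sym (∑-product X X² (𝟙 ∘ common? a b)))

      private
        X³⁻ : ∀ {x y z} → (x , y , z) ∈ X³ → x ∈ X × y ∈ X × z ∈ X
        X³⁻ t∈ = let x∈ , yz∈ = ∈-cartesianProduct⁻ X X² t∈ ; y∈ , z∈ = ∈-cartesianProduct⁻ X X yz∈ in x∈ , y∈ , z∈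

        -- The first parabola recovers x from y, so only y and z have to be compared.
        triple≡ : ∀ {a b x y z x′ y′ z′} → a ∈ A → (x , y , z) ∈ X³ → (x′ , y′ , z′) ∈ X³ →
          Common a b (x , y , z) → Common a b (x′ , y′ , z′) → Div (+ y ℤ.- + y′) → Div (+ z ℤ.- + z′) →
          (x , y , z) ≡ (x′ , y′ , z′)
        triple≡ a∈ t∈ t′∈ (c , _) (c′ , _) dy dz =
          let x∈ , y∈ , z∈ = X³⁻ t∈ ; x′∈ , y′∈ , z′∈ = X³⁻ t′∈ in
          glue x∈ x′∈ c c′ (≡-of-X y∈ y′∈ dy) (≡-of-X z∈ z′∈ dz)
          where
          glue : ∀ {x y z x′ y′ z′} → x ∈ X → x′ ∈ X → OnParabola n _ (+ x) (+ y) → OnParabola n _ (+ x′) (+ y′) →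
            y ≡ y′ → z ≡ z′ → (x , y , z) ≡ (x′ , y′ , z′)
          glue x∈ x′∈ c c′ refl refl = cong (_, _) (≡-of-X x∈ x′∈ (parabola-x-unique (A≢0 a∈) c c′))

        sum⇒difference : ∀ x y z → Div (x ℤ.+ z) → Div (y ℤ.+ z) → Div (x ℤ.- y)
        sum⇒difference x y z d e = lin₂ (+ 1) (- + 1) d e (lemma x y z)
          where
          lemma : ∀ x y z → x ℤ.- y ≡ + 1 ℤ.* (x ℤ.+ z) ℤ.+ - + 1 ℤ.* (y ℤ.+ z)
          lemma = ℤ-solve

        difference-trans : ∀ x y z → Div (x ℤ.- z) → Div (y ℤ.- z) → Div (x ℤ.- y)
        difference-trans x y z = sum⇒difference x y (- z)

        Div-refl : ∀ y → Div (y ℤ.- y)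
        Div-refl y = subst Div (sym (ℤₚ.i≡j⇒i-j≡0 {y} refl)) (divides (+ 0) refl)

      -- Here y and z are square roots of the same value, so z ≡ y or z ≡ -y, and a triple is
      -- encoded by y and a sign.
      common-diagonal : ∀ {a} → a ∈ A → ∑ X³ (𝟙 ∘ common? a a) ≤ p + p
      common-diagonal {a} a∈ = subst (∑ X³ (𝟙 ∘ common? a a) ≤_) size
        (count-≤ (common? a a) (map inj₁ X ++ map inj₂ X) X³-unique Sign total injective)
        where
        size : length (map {B = ℕ ⊎ ℕ} inj₁ X ++ map inj₂ X) ≡ p + p
        size = trans (length-++ (map inj₁ X)) (cong₂ _+_ (trans (length-map inj₁ X) (length-upTo p)) (trans (length-map inj₂ X) (length-upTo p)))
        Sign : ℕ × ℕ × ℕ → ℕ ⊎ ℕ → Set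
        Sign (x , y , z) (inj₁ y′) = y ≡ y′ × Div (+ z ℤ.- + y)
        Sign (x , y , z) (inj₂ y′) = y ≡ y′ × Div (+ z ℤ.+ + y)
        total : ∀ {t} → t ∈ X³ → Common a a t → ∃[ s ] s ∈ map inj₁ X ++ map inj₂ X × Sign t s
        total {x , y , z} t∈ (c , c′) = [ (λ d → inj₁ y , ∈-++⁺ˡ (∈-map⁺ inj₁ y∈) , refl , d)
                                        , (λ d → inj₂ y , ∈-++⁺ʳ (map inj₁ X) (∈-map⁺ inj₂ y∈) , refl , d)
                                        ]′ (parabola-y-± c c′)
          where y∈ = proj₁ (proj₂ (X³⁻ t∈))
        injective : ∀ {t t′ s} → t ∈ X³ → t′ ∈ X³ → Common a a t → Common a a t′ → Sign t s → Sign t′ s → t ≡ t′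
        injective {x , y , z} {_ , _ , z′} {inj₁ _} t∈ t′∈ c c′ (refl , d) (refl , d′) =
          triple≡ a∈ t∈ t′∈ c c′ (Div-refl (+ y)) (difference-trans (+ z) (+ z′) (+ y) d d′)
        injective {x , y , z} {_ , _ , z′} {inj₂ _} t∈ t′∈ c c′ (refl , d) (refl , d′) =
          triple≡ a∈ t∈ t′∈ c c′ (Div-refl (+ y)) (sum⇒difference (+ z) (+ z′) (+ y) d d′)

      module _ {a b : ℕ} (a∈ : a ∈ A) (b∈ : b ∈ A) (a≢b : a ≢ b) where

        private
          conic : ∀ {x y z} → Common a b (x , y , z) → OnConic n (+ a) (+ b) (+ y) (+ z)
          conic (c , c′) = parabolas⇒conic c c′

        common-through : ∀ {x₀ y₀ z₀} → Common a b (x₀ , y₀ , z₀) → ∑ X³ (𝟙 ∘ common? a b) ≤ 2 + p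
        common-through {x₀} {y₀} {z₀} c₀ = subst (∑ X³ (𝟙 ∘ common? a b) ≤_) (length-upTo (2 + p))
          (count-≤ (common? a b) (upTo (2 + p)) X³-unique Slope (λ _ → total) injective)
          where
          open Conic n (+ a) (+ b) (+ y₀) (+ z₀) ¬2 ¬n (A≢0 a∈) (A≢0 b∈)
            (a≢b ∘ ≡-of-small (A<p a∈) (A<p b∈)) (conic c₀)
          -- The points with z = z₀ have y = ± y₀; the others are told apart by their slope from (y₀ , z₀).
          Slope : ℕ × ℕ × ℕ → ℕ → Set
          Slope (x , y , z) 0             = Div (+ z ℤ.- + z₀) × Div (+ y ℤ.- + y₀)
          Slope (x , y , z) 1             = Div (+ z ℤ.- + z₀) × Div (+ y ℤ.+ + y₀)
          Slope (x , y , z) (suc (suc t)) = ¬ Div (+ z ℤ.- + z₀) × Div (+ y ℤ.- + y₀ ℤ.- + t ℤ.* (+ z ℤ.- + z₀))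
          lemma : ∀ y z t → y ℤ.- t ℤ.* z ≡ - + 1 ℤ.* (z ℤ.* t ℤ.- y)
          lemma = ℤ-solve
          total′ : ∀ {x y z} → Common a b (x , y , z) → Dec (Div (+ z ℤ.- + z₀)) →
            ∃[ s ] s ∈ upTo (2 + p) × Slope (x , y , z) s
          total′ c (yes d) = [ (λ e → 0 , ∈-upTo⁺ (s≤s z≤n) , d , e)
                             , (λ e → 1 , ∈-upTo⁺ (s≤s (s≤s z≤n)) , d , e)
                             ]′ (y-± (conic c) d)
          total′ {x} {y} {z} c (no ¬d) =
            let t , t<p , e = divide (+ z ℤ.- + z₀) (+ y ℤ.- + y₀) ¬d in
            suc (suc t) , ∈-upTo⁺ (s≤s (s≤s t<p)) , ¬d , lin₁ (- + 1) e (lemma (+ y ℤ.- + y₀) (+ z ℤ.- + z₀) (+ t))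
          total : ∀ {t} → Common a b t → ∃[ s ] s ∈ upTo (2 + p) × Slope t s
          total c = total′ c (+ p ∣? _)
          injective : ∀ {t t′ s} → t ∈ X³ → t′ ∈ X³ → Common a b t → Common a b t′ → Slope t s → Slope t′ s → t ≡ t′
          injective {_ , y , z} {_ , y′ , z′} {0} t∈ t′∈ c c′ (d , e) (d′ , e′) =
            triple≡ a∈ t∈ t′∈ c c′ (difference-trans (+ y) (+ y′) (+ y₀) e e′) (difference-trans (+ z) (+ z′) (+ z₀) d d′)
          injective {_ , y , z} {_ , y′ , z′} {1} t∈ t′∈ c c′ (d , e) (d′ , e′) =
            triple≡ a∈ t∈ t′∈ c c′ (sum⇒difference (+ y) (+ y′) (+ y₀) e e′) (difference-trans (+ z) (+ z′) (+ z₀) d d′)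
          injective {s = suc (suc t)} t∈ t′∈ c c′ (d , e) (d′ , e′) =
            let dy , dz = slope-injective (+ t) (conic c) (conic c′) d d′ e e′
            in triple≡ a∈ t∈ t′∈ c c′ dy dz

        -- Any common pair found by search serves as the base point of the projection; if there is
        -- none, the count is 0.
        common-off-diagonal : ∑ X³ (𝟙 ∘ common? a b) ≤ 2 + p
        common-off-diagonal = by-point (any? (common? a b) X³)
          where
          by-point : Dec (Any (Common a b) X³) → ∑ X³ (𝟙 ∘ common? a b) ≤ 2 + p
          by-point (yes some) = common-through (proj₂ (proj₂ (find some)))
          by-point (no none)  = ℕₚ.≤-trans (count-≤ (common? a b) [] X³-unique (λ _ (_ : ℕ) → ⊥)
            (λ t∈ c → contradiction (lose t∈ c) none) (λ _ _ _ _ ())) z≤n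

      -- One formula for both cases, so that it can be summed over b; the diagonal bound p + p
      -- exceeds the other by less than the extra p.
      common-≤ : ∀ {a b} → a ∈ A → b ∈ A → ∑ X³ (𝟙 ∘ common? a b) ≤ 2 + p + 𝟙 (a ≟ b) * p
      common-≤ {a} {b} a∈ b∈ = by-equality (a ≟ b)
        where
        by-equality : (d : Dec (a ≡ b)) → ∑ X³ (𝟙 ∘ common? a b) ≤ 2 + p + 𝟙 d * p
        by-equality (no a≢b)   = ℕₚ.≤-trans (common-off-diagonal a∈ b∈ a≢b) (ℕₚ.m≤m+n _ 0)
        by-equality (yes refl) = ℕₚ.≤-trans (common-diagonal a∈)
          (ℕₚ.≤-trans (ℕₚ.+-monoʳ-≤ p (ℕₚ.≤-reflexive (sym (ℕₚ.+-identityʳ p)))) (ℕₚ.m≤n+m (p + 1 * p) 2))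

      -- The square is expanded into pairs (a, b), and the sum over x for each pair counts common
      -- points. In each row the diagonal excess p occurs at most once.
      ∑-allRoots² : ∑ X (λ x → allRoots x * allRoots x) ≤ k * (k * (2 + p) + p)
      ∑-allRoots² = begin
        ∑ X (λ x → allRoots x * allRoots x)
          ≡⟨ ∑-cong X (λ x → ∑*∑ A A (λ a → roots a x) (λ b → roots b x)) ⟩
        ∑ X (λ x → ∑ A (λ a → ∑ A (λ b → roots a x * roots b x)))
          ≡⟨ ∑-swap X A (λ x a → ∑ A (λ b → roots a x * roots b x)) ⟩
        ∑ A (λ a → ∑ X (λ x → ∑ A (λ b → roots a x * roots b x)))
          ≡⟨ ∑-cong A (λ a → trans (∑-swap X A (λ x b → roots a x * roots b x)) (∑-cong A (roots² a))) ⟩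
        ∑ A (λ a → ∑ A (λ b → ∑ X³ (𝟙 ∘ common? a b)))
          ≤⟨ ∑-mono A row ⟩
        ∑ A (λ _ → k * (2 + p) + p)
          ≡⟨ ∑-const A _ ⟩
        k * (k * (2 + p) + p) ∎
        where
        open ℕₚ.≤-Reasoning
        row : ∀ {a} → a ∈ A → ∑ A (λ b → ∑ X³ (𝟙 ∘ common? a b)) ≤ k * (2 + p) + p
        row {a} a∈ = begin
          ∑ A (λ b → ∑ X³ (𝟙 ∘ common? a b))             ≤⟨ ∑-mono A (common-≤ a∈) ⟩
          ∑ A (λ b → 2 + p + 𝟙 (a ≟ b) * p)              ≡⟨ ∑-+ A (λ _ → 2 + p) (λ b → 𝟙 (a ≟ b) * p) ⟩
          ∑ A (λ _ → 2 + p) + ∑ A (λ b → 𝟙 (a ≟ b) * p)  ≡⟨ cong₂ _+_ (∑-const A (2 + p)) (∑-*ʳ A p (λ b → 𝟙 (a ≟ b))) ⟩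
          k * (2 + p) + ∑ A (λ b → 𝟙 (a ≟ b)) * p        ≤⟨ ℕₚ.+-monoʳ-≤ (k * (2 + p)) (ℕₚ.*-monoˡ-≤ p
                                                              (count-unique (a ≟_) A-unique (λ _ _ eq eq′ → trans (sym eq) eq′))) ⟩
          k * (2 + p) + 1 * p                            ≡⟨ cong (λ z → k * (2 + p) + z) (ℕₚ.*-identityˡ p) ⟩
          k * (2 + p) + p                                ∎

      private
        term? : ∀ x a → Dec (Div (+ a ℤ.* + x ℤ.+ n))
        term? x a = + p ∣? _

        -- For a ≠ x the clique condition makes a x + n a square, with two roots unless it vanishes
        -- and has one. The corrections pay 2 for a = x, where nothing is known, and 1 for a
        -- vanishing value.
        roots-≥ : ∀ {a x} → a ∈ A → x ∈ A → 2 ≤ roots a x + (𝟙 (a ≟ x) * 2 + 𝟙 (term? x a))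
        roots-≥ {a} {x} a∈ x∈ = by-cases (a ≟ x) (term? x a)
          where
          lemma₁ : ∀ y → + 2 ℤ.* y ≡ - + 1 ℤ.* (- y ℤ.- y)
          lemma₁ = ℤ-solve
          lemma₂ : ∀ n a x y → a ℤ.* x ℤ.+ n ≡ y ℤ.* y ℤ.+ - + 1 ℤ.* (y ℤ.* y ℤ.- (a ℤ.* x ℤ.+ n))
          lemma₂ = ℤ-solve
          lemma₃ : ∀ n a x y y′ → y′ ℤ.* y′ ℤ.- (a ℤ.* x ℤ.+ n) ≡
            + 1 ℤ.* (y ℤ.* y ℤ.- (a ℤ.* x ℤ.+ n)) ℤ.+ (y ℤ.- y′) ℤ.* (- y ℤ.- y′)
          lemma₃ = ℤ-solve
          -- The residue y′ of -y is a second root. If it equalled y, then 2 y ≡ 0, so y and with it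
          -- a x + n would vanish.
          opposite : ¬ Div (+ a ℤ.* + x ℤ.+ n) → ∀ {y y′} → OnParabola n (+ a) (+ x) (+ y) → Div (- + y ℤ.- + y′) →
            y ≢ y′ × OnParabola n (+ a) (+ x) (+ y′)
          opposite ¬e {y} {y′} (onParabola d) f =
            (λ { refl → ¬e (lin₂ (+ y) (- + 1) (cancel (+ y) ¬2 (lin₁ (- + 1) f (lemma₁ (+ y)))) d (lemma₂ n (+ a) (+ x) (+ y))) }) ,
            onParabola (lin₂ (+ 1) (+ y ℤ.- + y′) d f (lemma₃ n (+ a) (+ x) (+ y) (+ y′)))
          by-cases : (a≟x : Dec (a ≡ x)) (e? : Dec (Div (+ a ℤ.* + x ℤ.+ n))) → 2 ≤ roots a x + (𝟙 a≟x * 2 + 𝟙 e?)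
          by-cases (yes _)  _       = ℕₚ.≤-trans (ℕₚ.m≤m+n 2 _) (ℕₚ.m≤n+m _ (roots a x))
          by-cases (no a≢x) (yes _) =
            let y , y<p , d = square a∈ x∈ a≢x in
            ℕₚ.+-monoˡ-≤ 1 (count-≥ X {y ∷ []} (root? a x) ([] ∷ []) _≡_
              (λ { (here refl) → y , ∈-upTo⁺ y<p , d , refl })
              λ _ _ eq eq′ → trans eq (sym eq′))
          by-cases (no a≢x) (no ¬e) =
            let y , y<p , d = square a∈ x∈ a≢x ; y′ , y′<p , f = residue (- + y) ; y≢y′ , d′ = opposite ¬e d f in
            ℕₚ.≤-trans (count-≥ X {y ∷ y′ ∷ []} (root? a x) ((y≢y′ ∷ []) ∷ [] ∷ []) _≡_
              (λ { (here refl)         → y , ∈-upTo⁺ y<p , d , refl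
                 ; (there (here refl)) → y′ , ∈-upTo⁺ y′<p , d′ , refl })
              λ _ _ eq eq′ → trans eq (sym eq′))
            (ℕₚ.m≤m+n _ 0)

      -- The loss 3 is 2 for the term a = x plus 1 for the at most one a with a x ≡ -n.
      allRoots-≥ : ∀ {x} → x ∈ A → k * 2 ≤ allRoots x + 3
      allRoots-≥ {x} x∈ = begin
        k * 2
          ≡⟨ ∑-const A 2 ⟨
        ∑ A (λ _ → 2)
          ≤⟨ ∑-mono A (λ a∈ → roots-≥ a∈ x∈) ⟩
        ∑ A (λ a → roots a x + (𝟙 (a ≟ x) * 2 + 𝟙 (term? x a)))
          ≡⟨ ∑-+ A (λ a → roots a x) (λ a → 𝟙 (a ≟ x) * 2 + 𝟙 (term? x a)) ⟩
        allRoots x + ∑ A (λ a → 𝟙 (a ≟ x) * 2 + 𝟙 (term? x a))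
          ≡⟨ cong (λ z → allRoots x + z) (trans (∑-+ A (λ a → 𝟙 (a ≟ x) * 2) (λ a → 𝟙 (term? x a)))
               (cong (λ z → z + ∑ A (𝟙 ∘ term? x)) (∑-*ʳ A 2 (λ a → 𝟙 (a ≟ x))))) ⟩
        allRoots x + (∑ A (λ a → 𝟙 (a ≟ x)) * 2 + ∑ A (𝟙 ∘ term? x))
          ≤⟨ ℕₚ.+-monoʳ-≤ (allRoots x) (ℕₚ.+-mono-≤
               (ℕₚ.*-monoˡ-≤ 2 (count-unique (_≟ x) A-unique (λ _ _ eq eq′ → trans eq (sym eq′))))
               (count-unique (term? x) A-unique λ {a} {a′} a∈ a′∈ d d′ → ≡-of-small (A<p a∈) (A<p a′∈)
                 (cancel _ (A≢0 x∈) (lin₂ (+ 1) (- + 1) d d′ (lemma n (+ a) (+ a′) (+ x)))))) ⟩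
        allRoots x + 3 ∎
        where
        open ℕₚ.≤-Reasoning
        lemma : ∀ n a a′ x → x ℤ.* (a ℤ.- a′) ≡ + 1 ℤ.* (a ℤ.* x ℤ.+ n) ℤ.+ - + 1 ℤ.* (a′ ℤ.* x ℤ.+ n)
        lemma = ℤ-solve

      -- Let F = `allRoots`. Since F(x) - k ≥ k - 3 = j on A, the sum of (F(x) - k)² over all x is
      -- at least k j². Expanding it with the two moment bounds gives at most k (2 k + p). The
      -- linear terms stay on the left to avoid subtraction.
      variance-≤ : ∀ j → k ≡ 3 + j → j * j ≤ 2 * k + p
      variance-≤ j k≡ = ℕₚ.*-cancelˡ-≤ k {{>-nonZero (subst (1 ≤_) (sym k≡) (s≤s z≤n))}}
        (ℕₚ.+-cancelʳ-≤ (2 * k * (k * p)) _ _ (begin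
          k * (j * j) + 2 * k * (k * p)
            ≤⟨ ℕₚ.+-mono-≤ (ℕₚ.*-monoˡ-≤ (j * j) A⊆X) (ℕₚ.*-monoʳ-≤ (2 * k) ∑-allRoots) ⟩
          ∑ X (𝟙 ∘ (_∈? A)) * (j * j) + 2 * k * ∑ X allRoots
            ≡⟨ cong₂ _+_ (∑-*ʳ X (j * j) (𝟙 ∘ (_∈? A))) (∑-*ˡ X (2 * k) allRoots) ⟨
          ∑ X (λ x → 𝟙 (x ∈? A) * (j * j)) + ∑ X (λ x → 2 * k * allRoots x)
            ≡⟨ ∑-+ X (λ x → 𝟙 (x ∈? A) * (j * j)) (λ x → 2 * k * allRoots x) ⟨
          ∑ X (λ x → 𝟙 (x ∈? A) * (j * j) + 2 * k * allRoots x)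
            ≤⟨ ∑-mono X (λ {x} _ → pointwise x) ⟩
          ∑ X (λ x → allRoots x * allRoots x + k * k)
            ≡⟨ ∑-+ X (λ x → allRoots x * allRoots x) (λ _ → k * k) ⟩
          ∑ X (λ x → allRoots x * allRoots x) + ∑ X (λ _ → k * k)
            ≤⟨ ℕₚ.+-mono-≤ ∑-allRoots² (ℕₚ.≤-reflexive (trans (∑-const X (k * k)) (cong (_* (k * k)) (length-upTo p)))) ⟩
          k * (k * (2 + p) + p) + p * (k * k)
            ≡⟨ lemma k p ⟩
          k * (2 * k + p) + 2 * k * (k * p) ∎))
        where
        open ℕₚ.≤-Reasoning
        lemma : ∀ k p → k * (k * (2 + p) + p) + p * (k * k) ≡ k * (2 * k + p) + 2 * k * (k * p)
        lemma = solve-∀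
        A⊆X : k ≤ ∑ X (𝟙 ∘ (_∈? A))
        A⊆X = count-≥ X (_∈? A) A-unique _≡_ (λ {a} a∈ → a , ∈-upTo⁺ (A<p a∈) , a∈ , refl) (λ _ _ eq eq′ → trans eq (sym eq′))
        lemma₁ : ∀ j e → (3 + j) * 2 + e ≡ 3 + 2 * j + e + 3
        lemma₁ = solve-∀
        lemma₂ : ∀ j e → (j + e) * (j + e) + 2 * (3 + j) * (3 + 2 * j + e) ≡ (3 + 2 * j + e) * (3 + 2 * j + e) + (3 + j) * (3 + j)
        lemma₂ = solve-∀
        -- With k = 3 + j the hypothesis reads F = 3 + 2 j + e, so F - k = j + e ≥ j.
        deviation : ∀ {k} F → k ≡ 3 + j → k * 2 ≤ F + 3 → j * j + 2 * k * F ≤ F * F + k * k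
        deviation F refl h with e , eq ← ℕₚ.m≤n⇒∃[o]m+o≡n h
          with refl ← ℕₚ.+-cancelʳ-≡ 3 F (3 + 2 * j + e) (trans (sym eq) (lemma₁ j e)) =
          ℕₚ.≤-trans (ℕₚ.+-monoˡ-≤ _ (ℕₚ.*-mono-≤ (ℕₚ.m≤m+n j e) (ℕₚ.m≤m+n j e))) (ℕₚ.≤-reflexive (lemma₂ j e))
        pointwise′ : ∀ x (d : Dec (x ∈ A)) → 𝟙 d * (j * j) + 2 * k * allRoots x ≤ allRoots x * allRoots x + k * k
        -- Outside A only (F - k)² ≥ 0 is claimed.
        pointwise′ x (no  _)  = 2ab≤a²+b² (allRoots x) k
        pointwise′ x (yes x∈) = subst (λ z → z + 2 * k * allRoots x ≤ allRoots x * allRoots x + k * k)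
          (sym (ℕₚ.*-identityˡ (j * j))) (deviation (allRoots x) k≡ (allRoots-≥ x∈))
        pointwise : ∀ x → 𝟙 (x ∈? A) * (j * j) + 2 * k * allRoots x ≤ allRoots x * allRoots x + k * k
        pointwise x = pointwise′ x (x ∈? A)

-- Residue classes met by a set, and powers of p in its Vandermonde product.

module ResidueClasses where

  open Counting
  open ModularArithmetic
  open CliqueBound
  open import Data.Integer as ℤ using (ℤ; +_; -_)
  open import Data.Integer.Divisibility.Signed using (_∣?_; ∣⇒∣ᵤ)
  import Data.Integer.Properties as ℤₚ
  open import Data.Integer.Tactic.RingSolver using () renaming (solve-∀ to ℤ-solve)
  open import Data.List using (List; []; _∷_; length; map; filter; take)
  open import Data.List.Membership.Propositional using (_∈_)
  open import Data.List.Membership.Propositional.Properties using (∈-map⁻)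
  open import Data.List.Properties using (length-map; length-take; filter-all; filter-accept; filter-reject)
  open import Data.List.Relation.Unary.All as All using (All; []; _∷_)
  import Data.List.Relation.Unary.All.Properties as Allₚ
  open import Data.List.Relation.Unary.AllPairs as AllPairs using (AllPairs; []; _∷_)
  import Data.List.Relation.Unary.AllPairs.Properties as AllPairsₚ
  open import Data.List.Relation.Unary.Any using (Any; here; there; any?)
  open import Data.Nat using (ℕ; zero; suc; _+_; _*_; _^_; _<_; _≤_; ∣_-_∣; z≤n; s≤s)
  open import Data.Nat.Divisibility using (_∣_; *-pres-∣; ∣-trans; m∣m*n; 1∣_; ∣n⇒∣m*n)
  import Data.Nat.Properties as ℕₚ
  open import Data.Nat.Primality using (Prime)
  open import Data.Nat.Tactic.RingSolver using (solve-∀)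
  open import Data.Product using (_×_; _,_; ∃-syntax; proj₁; proj₂)
  open import Relation.Binary using (Symmetric)
  open import Relation.Binary.PropositionalEquality
  open import Relation.Nullary using (Dec; yes; no; ¬_; contradiction; ¬?)

  private variable
    X : Set

  ∏ : List X → (X → ℕ) → ℕ
  ∏ []       f = 1
  ∏ (x ∷ xs) f = f x * ∏ xs f

  ∏-∣ : ∀ {x} (xs : List X) f → x ∈ xs → f x ∣ ∏ xs f
  ∏-∣ (x ∷ xs) f (here refl) = m∣m*n (∏ xs f)
  ∏-∣ (x ∷ xs) f (there x∈)  = ∣n⇒∣m*n (f x) (∏-∣ xs f x∈)

  vandermonde : List ℕ → ℕ
  vandermonde []      = 1
  vandermonde (a ∷ S) = ∏ S (λ b → ∣ a - b ∣) * vandermonde S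

  lookupPair : ∀ {R : X → X → Set} {xs x y} → Symmetric R → AllPairs R xs → x ∈ xs → y ∈ xs → x ≢ y → R x y
  lookupPair sym-R (_  ∷ _)  (here refl) (here refl) x≢y = contradiction refl x≢y
  lookupPair sym-R (px ∷ _)  (here refl) (there y∈)  x≢y = All.lookup px y∈
  lookupPair sym-R (px ∷ _)  (there x∈)  (here refl) x≢y = sym-R (All.lookup px x∈)
  lookupPair sym-R (_  ∷ ps) (there x∈)  (there y∈)  x≢y = lookupPair sym-R ps x∈ y∈ x≢y

  ∣+m-+n∣ : ∀ m n → ℤ.∣ + m ℤ.- + n ∣ ≡ ∣ m - n ∣
  ∣+m-+n∣ m n = trans (cong ℤ.∣_∣ (ℤₚ.m-n≡m⊖n m n)) (distance m n)
    where
    distance : ∀ m n → ℤ.∣ m ℤ.⊖ n ∣ ≡ ∣ m - n ∣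
    distance zero    zero    = refl
    distance zero    (suc n) = refl
    distance (suc m) zero    = refl
    distance (suc m) (suc n) = trans (cong ℤ.∣_∣ (ℤₚ.[1+m]⊖[1+n]≡m⊖n m n)) (distance m n)

  module Representatives (p : ℕ) (p-prime : Prime p) where

    open Residues p p-prime

    Congruent : ℕ → ℕ → Set
    Congruent a b = Div (+ a ℤ.- + b)

    congruent? : ∀ a b → Dec (Congruent a b)
    congruent? a b = + p ∣? _

    -- Keeps the last member of each class, so its length is the number of classes met.
    reps : List ℕ → List ℕ
    reps [] = []
    reps (a ∷ S) with any? (congruent? a) S
    ... | yes _ = reps S
    ... | no  _ = a ∷ reps S

    -- Each dropped `a` is congruent to a later member, so its row of differences contributes a
    -- factor `p`; d counts the dropped members.
    reps-∣-vandermonde : ∀ S → ∃[ d ] d + length (reps S) ≡ length S × p ^ d ∣ vandermonde S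
    reps-∣-vandermonde [] = 0 , refl , 1∣ _
    reps-∣-vandermonde (a ∷ S) with any? (congruent? a) S | reps-∣-vandermonde S
    ... | yes some | d , eq , p^d∣ = suc d , cong suc eq , *-pres-∣ (p∣ some) p^d∣
      where
      p∣ : ∀ {S} → Any (Congruent a) S → p ∣ ∏ S (λ b → ∣ a - b ∣)
      p∣ {b ∷ S} (here d)  = ∣-trans (subst (p ∣_) (∣+m-+n∣ a b) (∣⇒∣ᵤ d)) (m∣m*n _)
      p∣ {b ∷ S} (there h) = ∣n⇒∣m*n (∣ a - b ∣) (p∣ h)
    ... | no  _    | d , eq , p^d∣ = d , trans (ℕₚ.+-suc d _) (cong suc eq) , ∣n⇒∣m*n (∏ S (λ b → ∣ a - b ∣)) p^d∣

    All-reps : ∀ {P : ℕ → Set} S → All P S → All P (reps S)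
    All-reps []      []        = []
    All-reps (a ∷ S) (pa ∷ ps) with any? (congruent? a) S
    ... | yes _ = All-reps S ps
    ... | no  _ = pa ∷ All-reps S ps

    AllPairs-reps : ∀ {R : ℕ → ℕ → Set} S → AllPairs R S → AllPairs (λ a b → R a b × ¬ Congruent a b) (reps S)
    AllPairs-reps []      []        = []
    AllPairs-reps (a ∷ S) (pa ∷ ps) with any? (congruent? a) S
    ... | yes _   = AllPairs-reps S ps
    ... | no none = All-reps S (All.zip (pa , Allₚ.¬Any⇒All¬ S none)) ∷ AllPairs-reps S ps

    nonzero? : ∀ a → Dec (¬ Div (+ a))
    nonzero? a = ¬? (+ p ∣? + a)

    -- Two multiples of `p` are congruent, so at most one member is lost.
    length-nonzero : ∀ {L} → AllPairs (λ a b → ¬ Congruent a b) L → length L ≤ 1 + length (filter nonzero? L)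
    length-nonzero [] = z≤n
    length-nonzero {a ∷ L} (a≉ ∷ ps) = by-zero (+ p ∣? + a)
      where
      lemma : ∀ a b → a ℤ.- b ≡ + 1 ℤ.* a ℤ.+ - + 1 ℤ.* b
      lemma = ℤ-solve
      by-zero : Dec (Div (+ a)) → suc (length L) ≤ 1 + length (filter nonzero? (a ∷ L))
      by-zero (no ¬a)   = subst (λ l → suc (length L) ≤ 1 + length l) (sym (filter-accept nonzero? ¬a)) (s≤s (length-nonzero ps))
      by-zero (yes a≈0) = subst (λ l → suc (length L) ≤ 1 + length l) (sym (trans
        (filter-reject nonzero? (λ ¬a → ¬a a≈0))
        (filter-all nonzero? (All.map (λ {b} a≉b b≈0 → a≉b (lin₂ (+ 1) (- + 1) a≈0 b≈0 (lemma (+ a) (+ b)))) a≉)))) ℕₚ.≤-refl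

    private
      rem : ℕ → ℕ
      rem a = proj₁ (residue (+ a))

      rem-< : ∀ a → rem a < p
      rem-< a = proj₁ (proj₂ (residue (+ a)))

      rem-≈ : ∀ a → Div (+ a ℤ.- + rem a)
      rem-≈ a = proj₂ (proj₂ (residue (+ a)))

    -- Transfers the clique bound to integers: remainders of incongruent members are distinct, and a
    -- root of a b + n reduces to a root for the remainders.
    length-clique-≤ : ∀ n → ¬ Div (+ 2) → ¬ Div n → ∀ {L} →
      AllPairs (λ a b → IsSquare (+ a ℤ.* + b ℤ.+ n) × ¬ Congruent a b) L → All (λ a → ¬ Div (+ a)) L →
      ∀ j → length L ≡ 3 + j → j * j ≤ 2 * length L + p
    length-clique-≤ n ¬2 ¬n {L} pairs nonzero j eq = subst (λ k → j * j ≤ 2 * k + p) (length-map rem L)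
      (variance-≤ j (trans (length-map rem L) eq))
      where
      rem-pair : ∀ {a b} → IsSquare (+ a ℤ.* + b ℤ.+ n) × ¬ Congruent a b →
        (∃[ y ] y < p × OnParabola n (+ rem a) (+ rem b) (+ y)) × rem a ≢ rem b
      rem-pair {a} {b} ((c , c²) , a≉b) =
        let y , y<p , d = residue c in
        (y , y<p , onParabola (lin₃ (- (c ℤ.+ + y)) (+ b) (+ rem a) d (rem-≈ a) (rem-≈ b)
          (trans (lemma₁ c (+ y) (+ rem a) (+ rem b) n) (trans
            (cong (λ z → - (c ℤ.+ + y) ℤ.* (c ℤ.- + y) ℤ.+ (z ℤ.- (+ rem a ℤ.* + rem b ℤ.+ n))) (sym c²))
            (lemma₂ (- (c ℤ.+ + y) ℤ.* (c ℤ.- + y)) (+ a) (+ b) (+ rem a) (+ rem b) n))))) ,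
        λ eq → a≉b (lin₂ (+ 1) (- + 1) (rem-≈ a) (rem-≈ b)
          (trans (lemma₃ (+ a) (+ b) (+ rem a)) (cong (λ r → + 1 ℤ.* (+ a ℤ.- + rem a) ℤ.+ - + 1 ℤ.* (+ b ℤ.- + r)) eq)))
        where
        lemma₁ : ∀ c y r s n → y ℤ.* y ℤ.- (r ℤ.* s ℤ.+ n) ≡ - (c ℤ.+ y) ℤ.* (c ℤ.- y) ℤ.+ (c ℤ.* c ℤ.- (r ℤ.* s ℤ.+ n))
        lemma₁ = ℤ-solve
        lemma₂ : ∀ z a b r s n → z ℤ.+ (a ℤ.* b ℤ.+ n ℤ.- (r ℤ.* s ℤ.+ n)) ≡ z ℤ.+ b ℤ.* (a ℤ.- r) ℤ.+ r ℤ.* (b ℤ.- s)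
        lemma₂ = ℤ-solve
        lemma₃ : ∀ a b r → a ℤ.- b ≡ + 1 ℤ.* (a ℤ.- r) ℤ.+ - + 1 ℤ.* (b ℤ.- r)
        lemma₃ = ℤ-solve

      A = map rem L
      A-pairs : AllPairs (λ r s → (∃[ y ] y < p × OnParabola n (+ r) (+ s) (+ y)) × r ≢ s) A
      A-pairs = AllPairsₚ.map⁺ (AllPairs.map rem-pair pairs)

      flip-pair : ∀ {r s} → (∃[ y ] y < p × OnParabola n (+ r) (+ s) (+ y)) → ∃[ y ] y < p × OnParabola n (+ s) (+ r) (+ y)
      flip-pair {r} {s} (y , y<p , onParabola d) = y , y<p ,
        onParabola (subst (λ z → Div (+ y ℤ.* + y ℤ.- (z ℤ.+ n))) (ℤₚ.*-comm (+ r) (+ s)) d)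

      A-nonzero : ∀ {r} → r ∈ A → ¬ Div (+ r)
      A-nonzero r∈ with a , a∈ , refl ← ∈-map⁻ rem r∈ =
        λ d → All.lookup nonzero a∈ (lin₂ (+ 1) (+ 1) d (rem-≈ a) (lemma (+ a) (+ rem a)))
        where
        lemma : ∀ a r → a ≡ + 1 ℤ.* r ℤ.+ + 1 ℤ.* (a ℤ.- r)
        lemma = ℤ-solve

      A<p : ∀ {r} → r ∈ A → r < p
      A<p r∈ with a , _ , refl ← ∈-map⁻ rem r∈ = rem-< a

      open Modulo.Clique p p-prime ¬2 n ¬n A (AllPairs.map proj₂ A-pairs) A<p A-nonzero
        (lookupPair flip-pair (AllPairs.map proj₁ A-pairs))

    -- With 10 + j classes at least 9 + j are nonzero. Exactly 9 + j of them are taken, and the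
    -- clique bound would give (6 + j)² ≤ 2 (9 + j) + (4 + j)², where the left side is larger by 2 +
    -- 2 j.
    length-reps-≤ : ∀ n → ¬ Div (+ 2) → ¬ Div n → ∀ {S} → AllPairs (λ a b → IsSquare (+ a ℤ.* + b ℤ.+ n)) S →
      ∀ j → p ≤ (4 + j) * (4 + j) → length (reps S) ≤ 9 + j
    length-reps-≤ n ¬2 ¬n {S} pairs j p≤ = ℕₚ.≮⇒≥ λ long → ℕₚ.<⇒≱ (gap j) (begin
      (6 + j) * (6 + j)    ≤⟨ length-clique-≤ n ¬2 ¬n
                                (AllPairsₚ.take⁺ (9 + j) (AllPairsₚ.filter⁺ nonzero? pairs′))
                                (Allₚ.take⁺ (9 + j) (Allₚ.all-filter nonzero? (reps S))) (6 + j) (length-L long) ⟩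
      2 * length L + p     ≡⟨ cong (λ k → 2 * k + p) (length-L long) ⟩
      2 * (9 + j) + p      ≤⟨ ℕₚ.+-monoʳ-≤ (2 * (9 + j)) p≤ ⟩
      2 * (9 + j) + (4 + j) * (4 + j)  ∎)
      where
      open ℕₚ.≤-Reasoning
      pairs′ = AllPairs-reps S pairs
      L = take (9 + j) (filter nonzero? (reps S))
      length-L : 9 + j < length (reps S) → length L ≡ 9 + j
      length-L long = trans (length-take (9 + j) (filter nonzero? (reps S))) (ℕₚ.m≤n⇒m⊓n≡m
        (ℕₚ.≤-pred (ℕₚ.≤-trans long (length-nonzero (AllPairs.map proj₂ pairs′)))))
      gap : ∀ j → 2 * (9 + j) + (4 + j) * (4 + j) < (6 + j) * (6 + j)
      gap j = ℕₚ.≤-trans (ℕₚ.m≤m+n _ (1 + 2 * j)) (ℕₚ.≤-reflexive (lemma j))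
        where
        lemma : ∀ j → suc (2 * (9 + j) + (4 + j) * (4 + j)) + (1 + 2 * j) ≡ (6 + j) * (6 + j)
        lemma = solve-∀

-- Coprime products and Chebyshev's lower bound for common multiples.

module Chebyshev where

  open ResidueClasses using (∏)
  open import Data.List using (List; []; _∷_; length)
  open import Data.List.Membership.Propositional using (_∈_)
  open import Data.List.Relation.Unary.All as All using (All; []; _∷_)
  open import Data.List.Relation.Unary.AllPairs using (AllPairs; []; _∷_)
  open import Data.List.Relation.Unary.Any using (here; there)
  open import Data.Nat.ListAction using (product)
  open import Data.Nat
  open import Data.Nat.Coprimality using (Coprime; coprime-divisor) renaming (sym to coprime-sym)
  open import Data.Nat.Divisibility
  open import Data.Nat.Primality using (Prime; prime⇒irreducible; prime⇒nonTrivial; prime⇒nonZero)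
  open import Data.Nat.Primality.Factorisation using (factorise; PrimeFactorisation)
  open import Data.Nat.Properties
  open import Data.Nat.Tactic.RingSolver using (solve-∀)
  open import Data.Product using (_×_; _,_; ∃-syntax; proj₁; proj₂)
  open import Data.Sum using (inj₁; inj₂; [_,_]′)
  open import Function using (_∘_)
  open import Relation.Binary.PropositionalEquality
  open import Relation.Nullary using (yes; no; ¬_; contradiction)

  private variable
    X Y : Set

  ∏-swap : ∀ (xs : List X) (ys : List Y) (f : X → Y → ℕ) →
           ∏ xs (λ x → ∏ ys (f x)) ≡ ∏ ys (λ y → ∏ xs (λ x → f x y))
  ∏-swap []       ys f = sym (ones ys)
    where
    ones : ∀ (ys : List X) → ∏ ys (λ _ → 1) ≡ 1
    ones []       = refl
    ones (_ ∷ ys) = trans (+-identityʳ _) (ones ys)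
  ∏-swap (x ∷ xs) ys f = trans (cong (∏ ys (f x) *_) (∏-swap xs ys f)) (sym (distrib ys))
    where
    lemma : ∀ a b c d → a * b * (c * d) ≡ a * c * (b * d)
    lemma = solve-∀
    distrib : ∀ ys → ∏ ys (λ y → f x y * ∏ xs (λ x → f x y)) ≡ ∏ ys (f x) * ∏ ys (λ y → ∏ xs (λ x → f x y))
    distrib []       = refl
    distrib (y ∷ ys) = trans (cong (f x y * _ *_) (distrib ys)) (lemma (f x y) _ (∏ ys (f x)) _)

  ∏-≤ : ∀ (xs : List X) {f c} → (∀ x → f x ≤ c) → ∏ xs f ≤ c ^ length xs
  ∏-≤ []       f≤c = ≤-refl
  ∏-≤ (x ∷ xs) f≤c = *-mono-≤ (f≤c x) (∏-≤ xs f≤c)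

  ∏≢0 : ∀ (xs : List X) {f} → (∀ {x} → x ∈ xs → NonZero (f x)) → NonZero (∏ xs f)
  ∏≢0 []       f≢0 = _
  ∏≢0 (x ∷ xs) f≢0 = m*n≢0 _ _ {{f≢0 (here refl)}} {{∏≢0 xs (f≢0 ∘ there)}}

  coprime-* : ∀ {m a b} → Coprime m a → Coprime m b → Coprime m (a * b)
  coprime-* {m} {a} m⊥a m⊥b (d∣m , d∣ab) =
    m⊥b (d∣m , coprime-divisor (λ (e∣d , e∣a) → m⊥a (∣-trans e∣d d∣m , e∣a)) d∣ab)

  coprime-^ : ∀ {m a} k → Coprime m a → Coprime m (a ^ k)
  coprime-^ zero    m⊥a (_ , d∣1) = ∣1⇒≡1 d∣1
  coprime-^ (suc k) m⊥a = coprime-* m⊥a (coprime-^ k m⊥a)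

  coprime-∏ : ∀ {m} (xs : List X) {f} → (∀ {x} → x ∈ xs → Coprime m (f x)) → Coprime m (∏ xs f)
  coprime-∏ []       c (_ , d∣1) = ∣1⇒≡1 d∣1
  coprime-∏ (x ∷ xs) c = coprime-* (c (here refl)) (coprime-∏ xs (c ∘ there))

  coprime-product-∣ : ∀ {m n o} → Coprime m n → m ∣ o → n ∣ o → m * n ∣ o
  coprime-product-∣ {m} {n} m⊥n m∣o (divides-refl q) =
    subst (_∣ q * n) (*-comm n m) (subst (n * m ∣_) (*-comm n q) (*-monoʳ-∣ n
      (coprime-divisor m⊥n (subst (m ∣_) (*-comm q n) m∣o))))

  ∏-coprime-∣ : ∀ {o} (xs : List X) {f} → AllPairs (λ x y → Coprime (f x) (f y)) xs →
                (∀ {x} → x ∈ xs → f x ∣ o) → ∏ xs f ∣ o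
  ∏-coprime-∣ []       []       f∣o = 1∣ _
  ∏-coprime-∣ (x ∷ xs) (c ∷ cs) f∣o =
    coprime-product-∣ (coprime-∏ xs (All.lookup c)) (f∣o (here refl)) (∏-coprime-∣ xs cs (f∣o ∘ there))

  prime∤⇒coprime : ∀ {p m} → Prime p → ¬ p ∣ m → Coprime p m
  prime∤⇒coprime p-prime p∤m (d∣p , d∣m) with prime⇒irreducible p-prime d∣p
  ... | inj₁ d≡1  = d≡1
  ... | inj₂ refl = contradiction d∣m p∤m

  primes-coprime : ∀ {p q} → Prime p → Prime q → p ≢ q → Coprime p q
  primes-coprime {p} {q} p-prime q-prime p≢q = prime∤⇒coprime p-prime λ p∣q →
    [ (λ p≡1 → contradiction (subst NonTrivial p≡1 (prime⇒nonTrivial p-prime)) λ ()) , p≢q ]′ (prime⇒irreducible q-prime p∣q)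

  -- Induction on the prime factors of j, dividing j and r by p. The hypothesis survives: for q = p
  -- it is used with exponent k + 1, and for q ≠ p the power of q is coprime to p.
  ∣-by-prime-powers : ∀ {j r} .{{_ : NonZero j}} → (∀ p k → Prime p → p ^ k ∣ j → p ^ k ∣ r) → j ∣ r
  ∣-by-prime-powers {j} {r} h = subst (_∣ r) (sym isFactorisation)
    (go factors factorsPrime r λ p k p-prime d → h p k p-prime (subst (p ^ k ∣_) (sym isFactorisation) d))
    where
    open PrimeFactorisation (factorise j)
    go : ∀ ps → All Prime ps → ∀ r → (∀ p k → Prime p → p ^ k ∣ product ps → p ^ k ∣ r) → product ps ∣ r
    go []       []             r h = 1∣ r
    go (p ∷ ps) (p-prime ∷ pr) r h with subst (_∣ r) (*-identityʳ p) (h p 1 p-prime (*-monoʳ-∣ p (1∣ product ps)))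
    ... | divides-refl r′ = subst (p * product ps ∣_) (*-comm p r′) (*-monoʳ-∣ p (go ps pr r′ h′))
      where
      instance
        p≢0 : NonZero p
        p≢0 = prime⇒nonZero p-prime
      h′ : ∀ q k → Prime q → q ^ k ∣ product ps → q ^ k ∣ r′
      h′ q k q-prime d with q ≟ p
      ... | yes refl = *-cancelˡ-∣ p (subst (p ^ suc k ∣_) (*-comm r′ p) (h p (suc k) p-prime (*-monoʳ-∣ p d)))
      ... | no  q≢p  = coprime-divisor (coprime-sym (coprime-^ k (primes-coprime p-prime q-prime (q≢p ∘ sym))))
        (subst (q ^ k ∣_) (*-comm r′ p) (h q k q-prime (∣n⇒∣m*n p d)))

  -- The entries of Leibniz's harmonic triangle are the unit fractions a! b! / (a + b + 1)!, and each is the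
  -- difference of two entries with smaller a; clearing denominators, r a! b! / (a + b + 1)! is an integer.
  leibniz-triangle : ∀ {r M} → (∀ j → 1 ≤ j → j ≤ M → j ∣ r) →
                     ∀ a b → suc (a + b) ≤ M → suc (a + b) ! ∣ r * (a ! * b !)
  leibniz-triangle {r} h zero b b<M = subst (suc b * b ! ∣_) (cong (r *_) (sym (*-identityˡ (b !))))
    (*-monoˡ-∣ (b !) (h (suc b) (s≤s z≤n) b<M))
  leibniz-triangle {r} {M} h (suc a) b a+b<M = ∣m+n∣m⇒∣n
    (subst (suc (suc (a + b)) ! ∣_) (sym (lemma r a b (a !) (b !)))
      (*-monoʳ-∣ (2 + (a + b)) (leibniz-triangle h a b (<⇒≤ a+b<M))))
    (subst (λ c → suc c ! ∣ r * (a ! * (suc b) !)) (+-suc a b) (leibniz-triangle h a (suc b) (subst (_≤ M) (cong suc (sym (+-suc a b))) a+b<M)))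
    where
    lemma : ∀ r a b x y → r * (x * (suc b * y)) + r * (suc a * x * y) ≡ (2 + (a + b)) * (r * (x * y))
    lemma = solve-∀

  -- The quotient (2k + 1)! / k!² grows by (2k + 3)(2k + 2) / (k + 1)² ≥ 4 at each step.
  4^k*k!²≤[2k+1]! : ∀ k → 4 ^ k * (k ! * k !) ≤ suc (k + k) !
  4^k*k!²≤[2k+1]! zero    = ≤-refl
  4^k*k!²≤[2k+1]! (suc k) = begin
    4 * 4 ^ k * (suc k * k ! * (suc k * k !))       ≡⟨ lemma₁ k (4 ^ k) (k !) ⟩
    4 * (suc k * suc k) * (4 ^ k * (k ! * k !))     ≤⟨ *-mono-≤ (≤-trans (m≤m+n (4 * (suc k * suc k)) (2 * k + 2)) (≤-reflexive (lemma₂ k))) (4^k*k!²≤[2k+1]! k) ⟩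
    (3 + (k + k)) * (2 + (k + k)) * suc (k + k) !   ≡⟨ *-assoc (3 + (k + k)) (2 + (k + k)) (suc (k + k) !) ⟩
    (3 + (k + k)) !                                 ≡⟨ cong (λ n → (2 + n) !) (+-suc k k) ⟨
    suc (suc k + suc k) !                           ∎
    where
    open ≤-Reasoning
    lemma₁ : ∀ k x y → 4 * x * (suc k * y * (suc k * y)) ≡ 4 * (suc k * suc k) * (x * (y * y))
    lemma₁ = solve-∀
    lemma₂ : ∀ k → 4 * (suc k * suc k) + (2 * k + 2) ≡ (3 + (k + k)) * (2 + (k + k))
    lemma₂ = solve-∀

  -- Choose k with 2k + 1 ≤ M ≤ 2k + 2. The central entry of the triangle gives (2k + 1)! ∣ r k!²,
  -- hence 4^k ≤ r; the factor 4 makes up for 2^M ≤ 4 · 4^k.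
  common-multiple-≥ : ∀ {r M} .{{_ : NonZero r}} → (∀ j → 1 ≤ j → j ≤ M → j ∣ r) → 1 ≤ M → 2 ^ M ≤ 4 * r
  common-multiple-≥ {r} {M} {{r≢0}} h 1≤M = begin
    2 ^ M                        ≤⟨ ^-monoʳ-≤ 2 M≤ ⟩
    2 ^ (2 + (k + k))            ≡⟨ trans (^-distribˡ-+-* 2 2 (k + k)) (cong (4 *_) (trans (^-distribˡ-+-* 2 k k) (sym (^-distribʳ-* k)))) ⟩
    4 * 4 ^ k                    ≤⟨ *-monoʳ-≤ 4 (*-cancelʳ-≤ (4 ^ k) r (k ! * k !) {{k !* k !≢0}}
                                     (≤-trans (4^k*k!²≤[2k+1]! k) (∣⇒≤ {{m*n≢0 r (k ! * k !) {{r≢0}} {{k !* k !≢0}}}} (leibniz-triangle h k k k+k<M)))) ⟩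
    4 * r                        ∎
    where
    open ≤-Reasoning
    ^-distribʳ-* : ∀ k → 4 ^ k ≡ 2 ^ k * 2 ^ k
    ^-distribʳ-* zero    = refl
    ^-distribʳ-* (suc k) = trans (cong (4 *_) (^-distribʳ-* k)) (lemma (2 ^ k))
      where
      lemma : ∀ x → 4 * (x * x) ≡ 2 * x * (2 * x)
      lemma = solve-∀
    half : ∀ M → 1 ≤ M → ∃[ k ] suc (k + k) ≤ M × M ≤ 2 + (k + k)
    half 1 _ = 0 , ≤-refl , s≤s z≤n
    half 2 _ = 0 , s≤s z≤n , ≤-refl
    half (suc (suc (suc M))) _ with half (suc M) (s≤s z≤n)
    ... | k , lo , hi = suc k , subst (λ n → suc (suc n) ≤ 3 + M) (sym (+-suc k k)) (s≤s (s≤s lo)) ,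
                                subst (λ n → 3 + M ≤ 3 + n) (sym (+-suc k k)) (s≤s (s≤s hi))
    k = proj₁ (half M 1≤M)
    k+k<M = proj₁ (proj₂ (half M 1≤M))
    M≤ = proj₂ (proj₂ (half M 1≤M))

  -- Descends from exponent e to the first power that fits below M; e is the fuel of the search.
  topPower : ℕ → ℕ → ℕ → ℕ
  topPower q M zero    = 1
  topPower q M (suc e) with q ^ suc e ≤? M
  ... | yes _ = q ^ suc e
  ... | no  _ = topPower q M e

  topPower-≤ : ∀ q M e → 1 ≤ M → topPower q M e ≤ M
  topPower-≤ q M zero    1≤M = 1≤M
  topPower-≤ q M (suc e) 1≤M with q ^ suc e ≤? M
  ... | yes h = h
  ... | no  _ = topPower-≤ q M e 1≤M

  topPower≢0 : ∀ q M e .{{_ : NonZero q}} → NonZero (topPower q M e)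
  topPower≢0 q M zero    = _
  topPower≢0 q M (suc e) with q ^ suc e ≤? M
  ... | yes _ = m^n≢0 q (suc e)
  ... | no  _ = topPower≢0 q M e

  m^k∣m^n : ∀ m {k n} → k ≤ n → m ^ k ∣ m ^ n
  m^k∣m^n m {k} k≤n with o , refl ← m≤n⇒∃[o]m+o≡n k≤n = subst (m ^ k ∣_) (sym (^-distribˡ-+-* m k o)) (m∣m*n (m ^ o))

  ^-∣-topPower : ∀ q M e k → k ≤ e → q ^ k ≤ M → q ^ k ∣ topPower q M e
  ^-∣-topPower q M zero    zero z≤n h = ∣-refl
  ^-∣-topPower q M (suc e) k k≤ h with q ^ suc e ≤? M | m≤n⇒m<n∨m≡n k≤
  ... | yes _ | _             = m^k∣m^n q k≤
  ... | no ¬h | inj₂ refl     = contradiction h ¬h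
  ... | no _  | inj₁ (s≤s k≤e) = ^-∣-topPower q M e k k≤e h

  -- Makes `M` sufficient fuel in `topPower q M M`: q ^ k ≤ M forces k < M.
  n<q^n : ∀ q n → 2 ≤ q → n < q ^ n
  n<q^n q zero    2≤q = s≤s z≤n
  n<q^n q (suc n) 2≤q = begin-strict
    suc n          ≤⟨ n<q^n q n 2≤q ⟩
    q ^ n          <⟨ m<m+n (q ^ n) (≤-trans (s≤s z≤n) (n<q^n q n 2≤q)) ⟩
    q ^ n + q ^ n  ≡⟨ cong (q ^ n +_) (+-identityʳ (q ^ n)) ⟨
    2 * q ^ n      ≤⟨ *-monoˡ-≤ (q ^ n) 2≤q ⟩
    q * q ^ n      ∎
    where open ≤-Reasoning

-- The sieve: comparing prime products with the Vandermonde product.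

module LargerSieve where

  open Counting using (∑)
  open ResidueClasses using (∏; ∏-∣; vandermonde; module Representatives)
  open Chebyshev
  open import Data.Integer as ℤ using (ℤ; +_)
  open import Data.Integer.Divisibility.Signed using (∣⇒∣ᵤ) renaming (_∣_ to _∣ℤ_)
  open import Data.List using (List; []; _∷_; length; downFrom)
  open import Data.List.Membership.Propositional.Properties using (∈-downFrom⁺)
  open import Data.List.Properties using (length-downFrom)
  open import Data.List.Relation.Unary.All as All using (All; []; _∷_)
  open import Data.List.Relation.Unary.AllPairs as AllPairs using (AllPairs; []; _∷_)
  open import Data.List.Relation.Unary.Unique.Propositional using (Unique)
  import Data.List.Relation.Unary.Unique.Propositional.Properties as Uniqueₚ
  open import Data.Nat
  open import Data.Nat.Coprimality using (Coprime) renaming (sym to coprime-sym)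
  open import Data.Nat.Divisibility
  open import Data.Nat.Primality using (Prime; prime?; prime⇒nonTrivial; prime⇒nonZero)
  open import Data.Nat.Properties
  open import Data.Nat.Tactic.RingSolver using (solve-∀)
  open import Data.Product using (_×_; _,_; ∃-syntax; proj₁; proj₂)
  open import Data.Sum using (_⊎_; inj₁; inj₂; [_,_]′)
  open import Function using (_∘_)
  open import Relation.Binary.PropositionalEquality
  open import Relation.Nullary using (Dec; yes; no; ¬_; contradiction; ¬?; _×-dec_)
  open import Relation.Nullary.Decidable using (toWitness)

  -- A rejected factor becomes 1, so that selected products still run over a full interval and can
  -- be interchanged.
  sift : ∀ {P : Set} → Dec P → ℕ → ℕ
  sift (yes _) q = q
  sift (no  _) q = 1

  sift-yes : ∀ {P : Set} (d : Dec P) q → P → sift d q ≡ q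
  sift-yes (yes _) q _ = refl
  sift-yes (no ¬p) q p = contradiction p ¬p

  sift-no : ∀ {P : Set} (d : Dec P) q → ¬ P → sift d q ≡ 1
  sift-no (yes p) q ¬p = contradiction p ¬p
  sift-no (no _)  q _  = refl

  *-^ : ∀ m n k → (m * n) ^ k ≡ m ^ k * n ^ k
  *-^ m n zero    = refl
  *-^ m n (suc k) = trans (cong (m * n *_) (*-^ m n k)) (lemma m n (m ^ k) (n ^ k))
    where
    lemma : ∀ a b c d → a * b * (c * d) ≡ a * c * (b * d)
    lemma = solve-∀

  -- Bernoulli's inequality (1 - 1/(x + 1))^r ≥ 1 - r/(x + 1) with denominators cleared and d = x +
  -- 1 - r.
  bernoulli : ∀ x d r → r + d ≡ suc x → d * suc x ^ r ≤ suc x * x ^ r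
  bernoulli x d zero    eq = *-monoˡ-≤ 1 (≤-reflexive eq)
  bernoulli x d (suc r) eq = begin
    d * (suc x * suc x ^ r)    ≡⟨ *-assoc d (suc x) _ ⟨
    d * suc x * suc x ^ r      ≤⟨ *-monoˡ-≤ (suc x ^ r) d[1+x]≤x[1+d] ⟩
    x * suc d * suc x ^ r      ≡⟨ *-assoc x (suc d) _ ⟩
    x * (suc d * suc x ^ r)    ≤⟨ *-monoʳ-≤ x (bernoulli x (suc d) r (trans (+-suc r d) eq)) ⟩
    x * (suc x * x ^ r)        ≡⟨ lemma₂ x (x ^ r) ⟩
    suc x * (x * x ^ r)        ∎
    where
    open ≤-Reasoning
    lemma₁ : ∀ d x → d + d * x ≡ d * suc x
    lemma₁ = solve-∀
    lemma₂ : ∀ x y → x * (suc x * y) ≡ suc x * (x * y)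
    lemma₂ = solve-∀
    lemma₃ : ∀ d x → x + d * x ≡ x * suc d
    lemma₃ = solve-∀
    d≤x : d ≤ x
    d≤x = subst (d ≤_) (suc-injective eq) (m≤n+m d r)
    d[1+x]≤x[1+d] : d * suc x ≤ x * suc d
    d[1+x]≤x[1+d] = subst₂ _≤_ (lemma₁ d x) (lemma₃ d x) (+-monoˡ-≤ (d * x) d≤x)

  -- From y to y + 1 the right side doubles, while the left side at most doubles: by Bernoulli (y/(y
  -- + 1))^r ≥ 1 - r/(y + 1) ≥ 1/2.
  power-≤-2^ : ∀ r c x → 2 * r ≤ suc x → x ^ r ≤ 2 ^ (c + x) → ∀ d → (d + x) ^ r ≤ 2 ^ (c + (d + x))
  power-≤-2^ r c x 2r≤ base zero    = base
  power-≤-2^ r c x 2r≤ base (suc d) = begin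
    suc y ^ r            ≤⟨ double ⟩
    2 * y ^ r            ≤⟨ *-monoʳ-≤ 2 (power-≤-2^ r c x 2r≤ base d) ⟩
    2 ^ suc (c + y)      ≡⟨ cong (2 ^_) (+-suc c y) ⟨
    2 ^ (c + suc y)      ∎
    where
    open ≤-Reasoning
    y = d + x
    2r≤y : 2 * r ≤ suc y
    2r≤y = ≤-trans 2r≤ (s≤s (m≤n+m x d))
    e = suc y ∸ r
    r+e : r + e ≡ suc y
    r+e = m+[n∸m]≡n (≤-trans (m≤m+n r _) 2r≤y)
    y<2e : suc y ≤ 2 * e
    y<2e = +-cancelˡ-≤ (2 * r) _ _ (≤-trans (+-monoˡ-≤ (suc y) 2r≤y)
      (≤-reflexive (trans (cong (λ z → z + z) (sym r+e)) (lemma₁ r e))))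
      where
      lemma₁ : ∀ r e → r + e + (r + e) ≡ 2 * r + 2 * e
      lemma₁ = solve-∀
    lemma₂ : ∀ x y → 2 * (x * y) ≡ x * (2 * y)
    lemma₂ = solve-∀
    double : suc y ^ r ≤ 2 * y ^ r
    double = *-cancelˡ-≤ (suc y) (begin
      suc y * suc y ^ r    ≤⟨ *-monoˡ-≤ (suc y ^ r) y<2e ⟩
      2 * e * suc y ^ r    ≡⟨ *-assoc 2 e _ ⟩
      2 * (e * suc y ^ r)  ≤⟨ *-monoʳ-≤ 2 (bernoulli y e r r+e) ⟩
      2 * (suc y * y ^ r)  ≡⟨ lemma₂ (suc y) (y ^ r) ⟩
      suc y * (2 * y ^ r)  ∎)

  -- Reduces the inequality to a finite check up to x, a point from which the growth argument
  -- applies.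
  ^-≤-2^ : ∀ r c x → 2 * r ≤ suc x → (∀ {i} → i < suc x → i ^ r ≤ 2 ^ (c + i)) → ∀ i → i ^ r ≤ 2 ^ (c + i)
  ^-≤-2^ r c x 2r≤ base i = by-size (≤-total i x)
    where
    by-size : i ≤ x ⊎ x ≤ i → i ^ r ≤ 2 ^ (c + i)
    by-size (inj₁ i≤x) = base (s≤s i≤x)
    by-size (inj₂ x≤i) = subst (λ z → z ^ r ≤ 2 ^ (c + z)) (m∸n+n≡m x≤i)
      (power-≤-2^ r c x 2r≤ (base ≤-refl) (i ∸ x))

  -- 131 bounds 32 log₂ i − i, which is largest near i = 32 / log 2 ≈ 46.
  i^32≤2^[131+i] : ∀ i → i ^ 32 ≤ 2 ^ (131 + i)
  i^32≤2^[131+i] = ^-≤-2^ 32 131 64 (≤ᵇ⇒≤ 64 65 _) (toWitness {a? = allUpTo? (λ i → i ^ 32 ≤? 2 ^ (131 + i)) 65} _)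

  ∏-distance≢0 : ∀ {a S} → All (a ≢_) S → NonZero (∏ S (λ b → ∣ a - b ∣))
  ∏-distance≢0 {a} {S} a∉ = ∏≢0 S λ b∈ → ≢-nonZero (All.lookup a∉ b∈ ∘ ∣m-n∣≡0⇒m≡n)

  vandermonde≢0 : ∀ {S} → Unique S → NonZero (vandermonde S)
  vandermonde≢0 []          = _
  vandermonde≢0 (a∉ ∷ uniq) = m*n≢0 _ _ {{∏-distance≢0 a∉}} {{vandermonde≢0 uniq}}

  -- Each of the m (m - 1)/2 differences is at most N². The factor N^m avoids subtraction in the
  -- exponent and later absorbs one factor N per level.
  vandermonde-≤ : ∀ N {S} → All (_≤ N ^ 2) S → vandermonde S * N ^ length S ≤ N ^ (length S * length S)
  vandermonde-≤ N []                   = ≤-refl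
  vandermonde-≤ N {a ∷ S} (a≤ ∷ S≤) = begin
    ∏ S (λ b → ∣ a - b ∣) * vandermonde S * (N * N ^ l)    ≡⟨ lemma₁ (∏ S (λ b → ∣ a - b ∣)) (vandermonde S) N (N ^ l) ⟩
    ∏ S (λ b → ∣ a - b ∣) * N * (vandermonde S * N ^ l)    ≤⟨ *-mono-≤ (*-monoˡ-≤ N (row S≤)) (vandermonde-≤ N S≤) ⟩
    (N ^ 2) ^ l * N * N ^ (l * l)                          ≡⟨ cong (_* N ^ (l * l)) (trans (*-comm _ N) (cong (N *_) (^-*-assoc N 2 l))) ⟩
    N ^ suc (2 * l) * N ^ (l * l)                          ≡⟨ ^-distribˡ-+-* N (suc (2 * l)) (l * l) ⟨
    N ^ (suc (2 * l) + l * l)                              ≡⟨ cong (N ^_) (lemma₂ l) ⟩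
    N ^ (suc l * suc l)                                    ∎
    where
    open ≤-Reasoning
    l = length S
    lemma₁ : ∀ x y z w → x * y * (z * w) ≡ x * z * (y * w)
    lemma₁ = solve-∀
    lemma₂ : ∀ l → suc (2 * l) + l * l ≡ suc l * suc l
    lemma₂ = solve-∀
    row : ∀ {S} → All (_≤ N ^ 2) S → ∏ S (λ b → ∣ a - b ∣) ≤ (N ^ 2) ^ length S
    row []                = ≤-refl
    row {b ∷ _} (b≤ ∷ S≤) = *-mono-≤ (≤-trans (∣m-n∣≤m⊔n a b) (⊔-lub a≤ b≤)) (row S≤)

  module Sieve (n : ℤ) .{{_ : ℤ.NonZero n}} where

    private
      N = ℤ.∣ n ∣

    Good : ℕ → Set
    Good q = Prime q × ¬ q ∣ N × q ≢ 2

    good? : ∀ q → Dec (Good q)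
    good? q = prime? q ×-dec ¬? (q ∣? N) ×-dec ¬? (q ≟ 2)

    weight : ℕ → ℕ → ℕ
    weight i q = sift (good? q ×-dec q ≤? i * i) q

    weight≢0 : ∀ i q → NonZero (weight i q)
    weight≢0 i q with good? q ×-dec q ≤? i * i
    ... | yes ((q-prime , _) , _) = prime⇒nonZero q-prime
    ... | no _ = _

    -- The i bases 2, ..., i + 1 each give their largest power up to i². The product is at most
    -- i^(2i) and is divisible by every prime power p^k ≤ i² with p ≤ i + 1.
    smoothPart : ℕ → ℕ
    smoothPart i = ∏ (downFrom i) (λ q → topPower (2 + q) (i * i) (i * i))

    smoothPart≢0 : ∀ i → NonZero (smoothPart i)
    smoothPart≢0 i = ∏≢0 (downFrom i) λ {q} _ → topPower≢0 (2 + q) (i * i) (i * i)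

    -- The cutoff `T` exceeds i² and can be shared by all levels, which allows the products over
    -- levels and over primes to be interchanged.
    module Level (i : ℕ) (1<i : 1 < i) (T : ℕ) (i*i<T : i * i < T) where

      goodPart : ℕ
      goodPart = ∏ (downFrom T) (weight i)

      private
        M = i * i

        1≤M : 1 ≤ M
        1≤M = *-mono-≤ (<⇒≤ 1<i) (<⇒≤ 1<i)

      -- A prime p ≤ i + 1 is covered by `smoothPart`. A larger one has p² > i², so k ≤ 1; it either
      -- divides N or, being larger than i + 1 > 2, occurs in `goodPart`.
      prime-power-∣ : ∀ p k → Prime p → p ^ k ≤ M → p ^ k ∣ goodPart * N * smoothPart i
      prime-power-∣ p k p-prime p^k≤M = by-size (p ≤? suc i)
        where
        2≤p : 2 ≤ p
        2≤p = nonTrivial⇒n>1 p {{prime⇒nonTrivial p-prime}}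
        k≤M : k ≤ M
        k≤M = ≤-trans (<⇒≤ (n<q^n p k 2≤p)) p^k≤M
        small : ∀ {p} → 2 ≤ p → p ≤ suc i → p ^ k ≤ M → p ^ k ∣ smoothPart i
        small {suc (suc q)} (s≤s (s≤s z≤n)) (s≤s q<i) h =
          ∣-trans (^-∣-topPower (2 + q) M M k k≤M h) (∏-∣ (downFrom i) (λ q → topPower (2 + q) M M) (∈-downFrom⁺ q<i))
        square> : suc i < p → ∀ k → ¬ p ^ suc (suc k) ≤ M
        square> i<p k h = <⇒≱ (begin-strict
          i * i              <⟨ *-mono-< (<⇒≤ i<p) (<⇒≤ i<p) ⟩
          p * p              ≤⟨ *-monoʳ-≤ p (m≤m*n p (p ^ k) {{m^n≢0 p k {{prime⇒nonZero p-prime}}}}) ⟩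
          p ^ suc (suc k)    ∎) h
          where open ≤-Reasoning
        by-divisor : suc i < p → p ≤ M → Dec (p ∣ N) → p ∣ goodPart * N
        by-divisor i<p p≤M (yes p∣N) = ∣n⇒∣m*n goodPart p∣N
        by-divisor i<p p≤M (no p∤N)  = ∣m⇒∣m*n N (subst (_∣ goodPart)
          (sift-yes (good? p ×-dec p ≤? M) p ((p-prime , p∤N , >⇒≢ (<-trans (s≤s 1<i) i<p)) , p≤M))
          (∏-∣ (downFrom T) (weight i) (∈-downFrom⁺ (≤-<-trans p≤M i*i<T))))
        large : suc i < p → ∀ k → p ^ k ≤ M → p ^ k ∣ goodPart * N
        large i<p zero          h = 1∣ _
        large i<p (suc zero)    h = subst (_∣ goodPart * N) (sym (*-identityʳ p))
          (by-divisor i<p (subst (_≤ M) (*-identityʳ p) h) (p ∣? N))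
        large i<p (suc (suc k)) h = contradiction h (square> i<p k)
        by-size : Dec (p ≤ suc i) → p ^ k ∣ goodPart * N * smoothPart i
        by-size (yes p≤) = ∣n⇒∣m*n (goodPart * N) (small 2≤p p≤ p^k≤M)
        by-size (no p≰)  = ∣m⇒∣m*n (smoothPart i) (large (≰⇒> p≰) k p^k≤M)

      -- By `prime-power-∣` the product on the right is a common multiple of 1, ..., i², so
      -- Chebyshev's bound applies to it.
      2^[i*i]≤ : 2 ^ (i * i) ≤ 4 * (goodPart * N * i ^ (2 * i))
      2^[i*i]≤ = ≤-trans
        (common-multiple-≥ {{m*n≢0 _ _ {{m*n≢0 goodPart N {{∏≢0 (downFrom T) λ {q} _ → weight≢0 i q}}}} {{smoothPart≢0 i}}}}
          (λ j 1≤j j≤M → ∣-by-prime-powers {{>-nonZero 1≤j}} λ p k p-prime d →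
            prime-power-∣ p k p-prime (≤-trans (∣⇒≤ {{>-nonZero 1≤j}} d) j≤M)) 1≤M)
        (*-monoʳ-≤ 4 (*-monoʳ-≤ (goodPart * N) smoothPart-≤))
        where
        smoothPart-≤ : smoothPart i ≤ i ^ (2 * i)
        smoothPart-≤ = ≤-trans (∏-≤ (downFrom i) λ q → topPower-≤ (2 + q) M M 1≤M)
          (≤-reflexive (trans (cong₂ _^_ (cong (i *_) (sym (*-identityʳ i))) (length-downFrom i)) (^-*-assoc i 2 i)))

      -- The s-th power turns i^(2i) into (i^(2s))^i, so that an integer bound for 2 s log₂ i
      -- suffices; larger s makes it more precise.
      level-≤ : ∀ s c → i ^ (2 * s) ≤ 2 ^ (c + i) → 2 ^ (s * (i * i)) ≤ (goodPart * N) ^ s * 2 ^ (2 * s + (c + i) * i)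
      level-≤ s c log-i = begin
        2 ^ (s * (i * i))                                  ≡⟨ cong (2 ^_) (*-comm s (i * i)) ⟩
        2 ^ (i * i * s)                                    ≡⟨ ^-*-assoc 2 (i * i) s ⟨
        (2 ^ (i * i)) ^ s                                  ≤⟨ ^-monoˡ-≤ s 2^[i*i]≤ ⟩
        (4 * (goodPart * N * i ^ (2 * i))) ^ s             ≡⟨ trans (*-^ 4 _ s) (cong₂ _*_ (^-*-assoc 2 2 s) (*-^ (goodPart * N) _ s)) ⟩
        2 ^ (2 * s) * (G * (i ^ (2 * i)) ^ s)              ≡⟨ cong (λ z → 2 ^ (2 * s) * (G * z)) (trans (^-*-assoc i (2 * i) s)
                                                               (trans (cong (i ^_) (lemma₁ i s)) (sym (^-*-assoc i (2 * s) i)))) ⟩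
        2 ^ (2 * s) * (G * (i ^ (2 * s)) ^ i)              ≤⟨ *-monoʳ-≤ (2 ^ (2 * s)) (*-monoʳ-≤ G (^-monoˡ-≤ i log-i)) ⟩
        2 ^ (2 * s) * (G * (2 ^ (c + i)) ^ i)              ≡⟨ cong (λ z → 2 ^ (2 * s) * (G * z)) (^-*-assoc 2 (c + i) i) ⟩
        2 ^ (2 * s) * (G * 2 ^ ((c + i) * i))              ≡⟨ lemma₂ (2 ^ (2 * s)) G _ ⟩
        G * (2 ^ (2 * s) * 2 ^ ((c + i) * i))              ≡⟨ cong (G *_) (^-distribˡ-+-* 2 (2 * s) ((c + i) * i)) ⟨
        G * 2 ^ (2 * s + (c + i) * i)                      ∎
        where
        open ≤-Reasoning
        G = (goodPart * N) ^ s
        lemma₁ : ∀ i s → 2 * i * s ≡ 2 * s * i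
        lemma₁ = solve-∀
        lemma₂ : ∀ x y z → x * (y * z) ≡ y * (x * z)
        lemma₂ = solve-∀

    -- The levels are i = 4 + j with j < J, that is 4 ≤ i ≤ |S| − 6.
    module _ {S : List ℕ} (pairs : AllPairs (λ a b → IsSquare (+ a ℤ.* + b ℤ.+ n)) S) (J : ℕ) (size : length S ≡ 9 + J) where

      -- For good q this is q to the number of levels i = 4 + j, j < K, with q ≤ i².
      column : ℕ → ℕ → ℕ
      column K q = ∏ (downFrom K) (λ j → weight (4 + j) q)

      column-bad : ∀ K {q} → ¬ Good q → column K q ≡ 1
      column-bad zero    bad = refl
      column-bad (suc K) {q} bad = cong₂ _*_ (sift-no (good? q ×-dec q ≤? (4 + K) * (4 + K)) q (bad ∘ proj₁)) (column-bad K bad)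

      module _ {q : ℕ} (good : Good q) where

        private
          q-prime = proj₁ good
          q∤n = proj₁ (proj₂ good)
          q≢2 = proj₂ (proj₂ good)

        open Representatives q q-prime using (reps; length-reps-≤)

        private
          ¬2 : ¬ (+ q) ∣ℤ (+ 2)
          ¬2 d = q≢2 (≤-antisym (∣⇒≤ (∣⇒∣ᵤ d)) (nonTrivial⇒n>1 q {{prime⇒nonTrivial q-prime}}))

          -- Until q has entered a level, the number of classes is uncontrolled and e = 0. On
          -- entering at i = 4 + K it is at most 9 + K, and afterwards e grows by at most 1 per
          -- level. At K = J the bound says that e is at most |S| minus the number of classes.
          Exponent : ℕ → Set
          Exponent K = ∃[ e ] column K q ≡ q ^ e × (e ≡ 0 ⊎ e + length (reps S) ≤ 9 + K)

        column-good : ∀ K → Exponent K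
        column-good zero    = 0 , refl , inj₁ refl
        column-good (suc K) = extend (column-good K) (q ≤? (4 + K) * (4 + K))
          where
          extend : Exponent K → Dec (q ≤ (4 + K) * (4 + K)) → Exponent (suc K)
          extend (e , eq , e≡0⊎e≤) (no q≰) = e ,
            trans (cong₂ _*_ (sift-no (good? q ×-dec q ≤? (4 + K) * (4 + K)) q (q≰ ∘ proj₂)) eq) (*-identityˡ (q ^ e)) ,
            [ inj₁ , inj₂ ∘ m≤n⇒m≤1+n ]′ e≡0⊎e≤
          extend (e , eq , e≡0⊎e≤) (yes q≤) = suc e ,
            cong₂ _*_ (sift-yes (good? q ×-dec q ≤? (4 + K) * (4 + K)) q (good , q≤)) eq ,
            inj₂ ([ (λ { refl → s≤s (length-reps-≤ n ¬2 (q∤n ∘ ∣⇒∣ᵤ) pairs K q≤) }) , s≤s ]′ e≡0⊎e≤)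

      column-coprime : ∀ {q r} → q ≢ r → Coprime (column J q) (column J r)
      column-coprime {q} {r} q≢r = by-goodness (good? q) (good? r)
        where
        by-goodness : Dec (Good q) → Dec (Good r) → Coprime (column J q) (column J r)
        by-goodness (no bad) _        = subst (λ z → Coprime z (column J r)) (sym (column-bad J bad)) (∣1⇒≡1 ∘ proj₁)
        by-goodness (yes _)  (no bad) = subst (Coprime (column J q)) (sym (column-bad J bad)) (∣1⇒≡1 ∘ proj₂)
        by-goodness (yes gq) (yes gr) =
          let e , eq , _ = column-good gq J ; f , eq′ , _ = column-good gr J in
          subst₂ Coprime (sym eq) (sym eq′)
            (coprime-^ f (coprime-sym (coprime-^ e (primes-coprime (proj₁ gr) (proj₁ gq) (q≢r ∘ sym)))))

      -- The exponent of good q does not exceed the number of members dropped by `reps`, which is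
      -- the power of q that pigeonhole provides.
      column-∣ : ∀ q → column J q ∣ vandermonde S
      column-∣ q = by-goodness (good? q)
        where
        by-goodness : Dec (Good q) → column J q ∣ vandermonde S
        by-goodness (no bad)   = subst (_∣ vandermonde S) (sym (column-bad J bad)) (1∣ _)
        by-goodness (yes good) = by-exponent (column-good good J)
          where
          open Representatives q (proj₁ good) using (reps; reps-∣-vandermonde)
          by-exponent : ∃[ e ] column J q ≡ q ^ e × (e ≡ 0 ⊎ e + length (reps S) ≤ 9 + J) → column J q ∣ vandermonde S
          by-exponent (e , eq , inj₁ refl) = subst (_∣ vandermonde S) (sym eq) (1∣ _)
          by-exponent (e , eq , inj₂ e≤)   =
            let d , d≡ , d∣ = reps-∣-vandermonde S in
            subst (_∣ vandermonde S) (sym eq)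
              (∣-trans (m^k∣m^n q (+-cancelʳ-≤ _ e d (≤-trans e≤ (≤-reflexive (trans (sym size) (sym d≡)))))) d∣)

      -- After interchanging the products, the columns of distinct q are coprime and divide
      -- separately.
      goodParts-∣ : ∀ T → ∏ (downFrom J) (λ j → ∏ (downFrom T) (weight (4 + j))) ∣ vandermonde S
      goodParts-∣ T = subst (_∣ vandermonde S) (sym (∏-swap (downFrom J) (downFrom T) (λ j → weight (4 + j))))
        (∏-coprime-∣ (downFrom T) (AllPairs.map column-coprime (Uniqueₚ.downFrom⁺ T)) (λ {q} _ → column-∣ q))

      -- Multiplies the level inequalities. They contribute one N each, and the resulting N^J is
      -- covered by the spare N^|S| in `vandermonde-≤`.
      sieve : ∀ s c → (∀ i → i ^ (2 * s) ≤ 2 ^ (c + i)) → Unique S → All (_≤ N ^ 2) S →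
        2 ^ ∑ (downFrom J) (λ j → s * ((4 + j) * (4 + j))) ≤
        N ^ (length S * length S * s) * 2 ^ ∑ (downFrom J) (λ j → 2 * s + (c + (4 + j)) * (4 + j))
      sieve s c log-i uniq S≤ = ≤-trans (levels J ≤-refl) (*-monoˡ-≤ _ (≤-trans (^-monoˡ-≤ s bound) (≤-reflexive (^-*-assoc N (length S * length S) s))))
        where
        open ≤-Reasoning
        -- Larger than i² for every level i = 4 + K with K < J.
        T = suc ((4 + J) * (4 + J))
        goodPart : ℕ → ℕ
        goodPart j = ∏ (downFrom T) (weight (4 + j))
        bound : ∏ (downFrom J) goodPart * N ^ J ≤ N ^ (length S * length S)
        bound = ≤-trans (*-mono-≤ (∣⇒≤ {{vandermonde≢0 uniq}} (goodParts-∣ T))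
            (^-monoʳ-≤ N (subst (J ≤_) (sym size) (m≤n+m J 9))))
          (vandermonde-≤ N S≤)
        levels : ∀ K → K ≤ J → 2 ^ ∑ (downFrom K) (λ j → s * ((4 + j) * (4 + j))) ≤
          (∏ (downFrom K) goodPart * N ^ K) ^ s * 2 ^ ∑ (downFrom K) (λ j → 2 * s + (c + (4 + j)) * (4 + j))
        levels zero    _   = ≤-reflexive (sym (trans (*-identityʳ _) (^-zeroˡ s)))
        levels (suc K) K<J = begin
          2 ^ (s * (i * i) + X)                              ≡⟨ ^-distribˡ-+-* 2 (s * (i * i)) X ⟩
          2 ^ (s * (i * i)) * 2 ^ X                          ≤⟨ *-mono-≤ (level-≤ s c (log-i i)) (levels K (<⇒≤ K<J)) ⟩
          (P * N) ^ s * 2 ^ y * ((Q * N ^ K) ^ s * 2 ^ Y)    ≡⟨ lemma₁ ((P * N) ^ s) (2 ^ y) ((Q * N ^ K) ^ s) (2 ^ Y) ⟩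
          (P * N) ^ s * (Q * N ^ K) ^ s * (2 ^ y * 2 ^ Y)    ≡⟨ cong₂ _*_ (trans (sym (*-^ (P * N) (Q * N ^ K) s)) (cong (_^ s) (lemma₁ P N Q (N ^ K))))
                                                                  (sym (^-distribˡ-+-* 2 y Y)) ⟩
          (P * Q * (N * N ^ K)) ^ s * 2 ^ (y + Y)            ∎
          where
          i = 4 + K
          open Level i (s≤s (s≤s z≤n)) T (s≤s (*-mono-≤ (+-monoʳ-≤ 4 (<⇒≤ K<J)) (+-monoʳ-≤ 4 (<⇒≤ K<J)))) using (level-≤)
          P = goodPart K
          Q = ∏ (downFrom K) goodPart
          y = 2 * s + (c + i) * i
          X = ∑ (downFrom K) (λ j → s * ((4 + j) * (4 + j)))
          Y = ∑ (downFrom K) (λ j → 2 * s + (c + (4 + j)) * (4 + j))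
          lemma₁ : ∀ a b c d → a * b * (c * d) ≡ a * c * (b * d)
          lemma₁ = solve-∀

-- Comparison of the main and error exponents with m³.

module Growth where

  open Counting using (∑)
  open import Data.List using (downFrom)
  open import Data.Nat
  open import Data.Nat.Properties
  open import Data.Nat.Tactic.RingSolver using (solve-∀)
  open import Relation.Binary.PropositionalEquality

  -- The exponents X and Y of 2 in `sieve` for s = 16 and c = 131, the constants of
  -- `i^32≤2^[131+i]`.
  mainTerm errorTerm : ℕ → ℕ
  mainTerm  J = ∑ (downFrom J) (λ j → 16 * ((4 + j) * (4 + j)))
  errorTerm J = ∑ (downFrom J) (λ j → 2 * 16 + (131 + (4 + j)) * (4 + j))

  -- With m = 9 + J this is 16 m³ + 1 ≤ (u/v)(X - Y), which together with 16 m² log N ≥ (X - Y) log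
  -- 2 gives m < (u/v) log N / log 2. The 1 leaves room for a strict inequality.
  Dominates : (u v J : ℕ) → Set
  Dominates u v J = v * (16 * ((9 + J) * ((9 + J) * (9 + J))) + 1) + u * errorTerm J ≤ u * mainTerm J

  dominates-step : ∀ u v J →
    v * (16 * (3 * ((9 + J) * (9 + J)) + 3 * (9 + J) + 1)) + u * (2 * 16 + (131 + (4 + J)) * (4 + J)) ≤
      u * (16 * ((4 + J) * (4 + J))) →
    Dominates u v J → Dominates u v (suc J)
  dominates-step u v J increment dominates = subst₂ _≤_
    (lemma₁ u v (9 + J) (2 * 16 + (131 + (4 + J)) * (4 + J)) (errorTerm J))
    (sym (*-distribˡ-+ u (16 * ((4 + J) * (4 + J))) (mainTerm J)))
    (+-mono-≤ increment dominates)
    where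
    lemma₁ : ∀ u v m y Y → v * (16 * (3 * (m * m) + 3 * m + 1)) + u * y + (v * (16 * (m * (m * m)) + 1) + u * Y) ≡
      v * (16 * (suc m * (suc m * suc m)) + 1) + u * (y + Y)
    lemma₁ = solve-∀

  -- The start m = 55 is computed, and the slack of each step is a polynomial in k with positive
  -- coefficients. The ratio is admissible because 13/2 < 11.006 · 37/60.
  dominates-13/2 : ∀ k → Dominates 13 2 (k + 46)
  dominates-13/2 zero    = ≤ᵇ⇒≤ _ _ _
  dominates-13/2 (suc k) = dominates-step 13 2 (k + 46)
    (≤-trans (m≤m+n _ (99 * (k * k) + 7141 * k + 106222)) (≤-reflexive (lemma k))) (dominates-13/2 k)
    where
    lemma : ∀ k → 2 * (16 * (3 * ((9 + (k + 46)) * (9 + (k + 46))) + 3 * (9 + (k + 46)) + 1)) + 13 * (2 * 16 + (131 + (4 + (k + 46))) * (4 + (k + 46)))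
      + (99 * (k * k) + 7141 * k + 106222) ≡ 13 * (16 * ((4 + (k + 46)) * (4 + (k + 46))))
    lemma = solve-∀

  -- The same with start m = 100; here 5 < 8.37 · 37/60.
  dominates-5 : ∀ k → Dominates 5 1 (k + 91)
  dominates-5 zero    = ≤ᵇ⇒≤ _ _ _
  dominates-5 (suc k) = dominates-step 5 1 (k + 91)
    (≤-trans (m≤m+n _ (27 * (k * k) + 3947 * k + 129674)) (≤-reflexive (lemma k))) (dominates-5 k)
    where
    lemma : ∀ k → 1 * (16 * (3 * ((9 + (k + 91)) * (9 + (k + 91))) + 3 * (9 + (k + 91)) + 1)) + 5 * (2 * 16 + (131 + (4 + (k + 91))) * (4 + (k + 91)))
      + (27 * (k * k) + 3947 * k + 129674) ≡ 5 * (16 * ((4 + (k + 91)) * (4 + (k + 91))))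
    lemma = solve-∀

-- Riemann sums of the logarithm and lower bounds for log N.

module LogarithmBounds where

  open LogConvergence
  open import Data.Integer as ℤ using (ℤ; +_)
  import Data.Integer.Properties as ℤₚ
  open import Data.Nat as ℕ using (ℕ; zero; suc)
  import Data.Nat.Properties as ℕₚ
  open import Data.Nat.Tactic.RingSolver using (solve-∀)
  open import Data.Product using (_,_; ∃-syntax)
  open import Data.Rational
  import Data.Rational.Properties as ℚₚ
  open import Data.Rational.Solver using (module +-*-Solver)
  import Data.Rational.Unnormalised as ℚᵘ
  import Data.Rational.Unnormalised.Properties as ℚᵘₚ
  open import Relation.Binary.PropositionalEquality

  ι : ℕ → ℚ
  ι n = + n / 1

  toℚᵘ-ι : ∀ n → toℚᵘ (ι n) ℚᵘ.≃ ℚᵘ.mkℚᵘ (+ n) 0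
  toℚᵘ-ι n = ℚₚ.toℚᵘ-fromℚᵘ (ℚᵘ.mkℚᵘ (+ n) 0)

  ι-+ : ∀ m n → ι (m ℕ.+ n) ≡ ι m + ι n
  ι-+ m n = ℚₚ.toℚᵘ-injective (ℚᵘₚ.≃-trans (toℚᵘ-ι (m ℕ.+ n)) (ℚᵘₚ.≃-trans (ℚᵘ.*≡* eq)
    (ℚᵘₚ.≃-trans (ℚᵘₚ.+-cong (ℚᵘₚ.≃-sym (toℚᵘ-ι m)) (ℚᵘₚ.≃-sym (toℚᵘ-ι n))) (ℚᵘₚ.≃-sym (ℚₚ.toℚᵘ-homo-+ (ι m) (ι n))))))
    where
    eq : + (m ℕ.+ n) ℤ.* + 1 ≡ (+ m ℤ.* + 1 ℤ.+ + n ℤ.* + 1) ℤ.* + 1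
    eq = cong (ℤ._* + 1) (sym (cong₂ ℤ._+_ (ℤₚ.*-identityʳ (+ m)) (ℤₚ.*-identityʳ (+ n))))

  ι-* : ∀ m n → ι (m ℕ.* n) ≡ ι m * ι n
  ι-* m n = ℚₚ.toℚᵘ-injective (ℚᵘₚ.≃-trans (toℚᵘ-ι (m ℕ.* n)) (ℚᵘₚ.≃-trans (ℚᵘ.*≡* eq)
    (ℚᵘₚ.≃-trans (ℚᵘₚ.*-cong (ℚᵘₚ.≃-sym (toℚᵘ-ι m)) (ℚᵘₚ.≃-sym (toℚᵘ-ι n))) (ℚᵘₚ.≃-sym (ℚₚ.toℚᵘ-homo-* (ι m) (ι n))))))
    where
    eq : + (m ℕ.* n) ℤ.* + 1 ≡ (+ m ℤ.* + n) ℤ.* + 1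
    eq = cong (ℤ._* + 1) (ℤₚ.pos-* m n)

  ι-mono-≤ : ∀ m n → m ℕ.≤ n → ι m ≤ ι n
  ι-mono-≤ m n m≤n = ℚₚ.toℚᵘ-cancel-≤ (ℚᵘₚ.≤-respˡ-≃ (ℚᵘₚ.≃-sym (toℚᵘ-ι m)) (ℚᵘₚ.≤-respʳ-≃ (ℚᵘₚ.≃-sym (toℚᵘ-ι n))
    (ℚᵘ.*≤* (ℤₚ.*-monoʳ-≤-nonNeg (+ 1) (ℤ.+≤+ m≤n)))))

  ι-*-recip-<½ : ∀ a b → 2 ℕ.* a ℕ.< suc b → ι a * recip b < ½
  ι-*-recip-<½ a b 2a<b = ℚₚ.toℚᵘ-cancel-<
    (ℚᵘₚ.<-respˡ-≃ (ℚᵘₚ.≃-sym (ℚᵘₚ.≃-trans (ℚₚ.toℚᵘ-homo-* (ι a) (recip b)) (ℚᵘₚ.*-cong (toℚᵘ-ι a) (toℚᵘ-recip b))))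
      (ℚᵘ.*<* (subst₂ ℤ._<_ eq₁ eq₂ (ℤ.+<+ 2a<b))))
    where
    eq₁ : + (2 ℕ.* a) ≡ (+ a ℤ.* + 1) ℤ.* + 2
    eq₁ = trans (cong +_ (ℕₚ.*-comm 2 a)) (trans (ℤₚ.pos-* a 2) (cong (ℤ._* + 2) (sym (ℤₚ.*-identityʳ (+ a)))))
    eq₂ : + suc b ≡ + 1 ℤ.* + (1 ℕ.* suc b)
    eq₂ = trans (cong +_ (sym (ℕₚ.*-identityˡ (suc b)))) (sym (ℤₚ.*-identityˡ _))

  ∑-≤-+ : ∀ a b f → (∀ i → 0ℚ ≤ f i) → ∑< a f ≤ ∑< (a ℕ.+ b) f
  ∑-≤-+ a zero    f 0≤f = ℚₚ.≤-reflexive (cong (λ m → ∑< m f) (sym (ℕₚ.+-identityʳ a)))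
  ∑-≤-+ a (suc b) f 0≤f = subst (∑< a f ≤_) (cong (λ m → ∑< m f) (sym (ℕₚ.+-suc a b)))
    (ℚₚ.≤-trans (∑-≤-+ a b f 0≤f) (subst (_≤ ∑< (a ℕ.+ b) f + f (a ℕ.+ b)) (ℚₚ.+-identityʳ _) (ℚₚ.+-monoʳ-≤ (∑< (a ℕ.+ b) f) (0≤f (a ℕ.+ b)))))

  riemann-mono : ∀ {M N} k → M ℕ.≤ N → riemann M k ≤ riemann N k
  riemann-mono {M} {N} k M≤N =
    let d , eq = ℕₚ.m≤n⇒∃[o]m+o≡n (ℕₚ.*-monoˡ-≤ k (ℕₚ.∸-monoˡ-≤ 1 M≤N)) in
    subst (λ m → riemann M k ≤ ∑< m (λ i → recip (k ℕ.+ i))) eq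
      (∑-≤-+ ((M ℕ.∸ 1) ℕ.* k) d _ λ i → ℚₚ.<⇒≤ (0<recip (k ℕ.+ i)))

  -- The sum of 1/n over k < n ≤ A B k is split at A k; its second part is the sum for B with the
  -- finer mesh 1/(A k).
  riemann-* : ∀ A B k .{{_ : ℕ.NonZero A}} .{{_ : ℕ.NonZero B}} → riemann (A ℕ.* B) k ≡ riemann A k + riemann B (A ℕ.* k)
  riemann-* (suc A) (suc B) k = trans (cong (λ m → ∑< m f) (lemma A B k))
    (trans (∑-split (A ℕ.* k) (B ℕ.* (suc A ℕ.* k)) f)
      (cong (λ z → ∑< (A ℕ.* k) f + z) (∑-cong (B ℕ.* (suc A ℕ.* k)) λ i → cong recip (sym (ℕₚ.+-assoc k (A ℕ.* k) i)))))
    where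
    f = λ i → recip (k ℕ.+ i)
    lemma : ∀ A B k → (B ℕ.+ A ℕ.* suc B) ℕ.* k ≡ A ℕ.* k ℕ.+ B ℕ.* (suc A ℕ.* k)
    lemma = solve-∀

  refine-lower′ : ∀ N k A .{{_ : ℕ.NonZero A}} → riemann N (suc k) ≤ riemann N (A ℕ.* suc k)
  refine-lower′ N k (suc A) = subst (λ m → riemann N (suc k) ≤ riemann N m) (ℕₚ.*-comm (suc k) (suc A)) (refine-lower N k A)

  refine-upper′ : ∀ N k A .{{_ : ℕ.NonZero A}} → riemann N (A ℕ.* suc k) ≤ riemann N (suc k) + recip k
  refine-upper′ N k (suc A) = subst (λ m → riemann N m ≤ riemann N (suc k) + recip k) (ℕₚ.*-comm (suc k) (suc A)) (refine-upper N k A)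

  riemann-^ : ∀ A s k .{{_ : ℕ.NonZero A}} → riemann (A ℕ.^ suc s) k ≡ riemann (A ℕ.^ s) k + riemann A (A ℕ.^ s ℕ.* k)
  riemann-^ A s k = trans (cong (λ m → riemann m k) (ℕₚ.*-comm A (A ℕ.^ s))) (riemann-* (A ℕ.^ s) A k {{ℕₚ.m^n≢0 A s}})

  suc-* : ∀ s c → ι s * c + c ≡ ι (suc s) * c
  suc-* s c = trans (solve 2 (λ s c → s :* c :+ c := (con 1ℚ :+ s) :* c) refl (ι s) c) (cong (_* c) (sym (ι-+ 1 s)))
    where open +-*-Solver

  -- Each further factor A adds a sum for A on a finer mesh, which exceeds the one of mesh 1/(k + 1)
  -- by at most `recip k`. Refinement never decreases the sum, whence the lower bound `riemann-^-≥`
  -- without error.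
  riemann-^-≤ : ∀ A s k .{{_ : ℕ.NonZero A}} → riemann (A ℕ.^ s) (suc k) ≤ ι s * (riemann A (suc k) + recip k)
  riemann-^-≤ A zero    k = ℚₚ.≤-reflexive (sym (ℚₚ.*-zeroˡ (riemann A (suc k) + recip k)))
  riemann-^-≤ A (suc s) k = ℚₚ.≤-trans (ℚₚ.≤-reflexive (riemann-^ A s (suc k)))
    (ℚₚ.≤-trans (ℚₚ.+-mono-≤ (riemann-^-≤ A s k) (refine-upper′ A k (A ℕ.^ s) {{ℕₚ.m^n≢0 A s}}))
      (ℚₚ.≤-reflexive (suc-* s (riemann A (suc k) + recip k))))

  riemann-^-≥ : ∀ A t k .{{_ : ℕ.NonZero A}} → ι t * riemann A (suc k) ≤ riemann (A ℕ.^ t) (suc k)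
  riemann-^-≥ A zero    k = ℚₚ.≤-reflexive (ℚₚ.*-zeroˡ (riemann A (suc k)))
  riemann-^-≥ A (suc t) k = ℚₚ.≤-trans (ℚₚ.≤-reflexive (sym (suc-* t (riemann A (suc k)))))
    (ℚₚ.≤-trans (ℚₚ.+-mono-≤ (riemann-^-≥ A t k) (refine-lower′ A k (A ℕ.^ t) {{ℕₚ.m^n≢0 A t}}))
      (ℚₚ.≤-reflexive (sym (riemann-^ A t (suc k)))))

  -- 37/60 = 1/4 + 1/5 + 1/6 is the Riemann sum of mesh 1/3 for log 2.
  37/60≤riemann-2 : ∀ k → + 37 / 60 ≤ riemann 2 (suc k) + recip k
  37/60≤riemann-2 k = begin
    + 37 / 60                                       ≡⟨ solve 2 (λ x y → x := y :+ (x :- y)) refl (+ 37 / 60) (riemann 2 (suc k)) ⟩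
    riemann 2 (suc k) + (riemann 2 3 - riemann 2 (suc k))  ≤⟨ ℚₚ.+-monoʳ-≤ (riemann 2 (suc k)) (riemann-≤ 2 2 k) ⟩
    riemann 2 (suc k) + recip k                     ∎
    where
    open ℚₚ.≤-Reasoning
    open +-*-Solver

  ι-nonNeg : ∀ n → NonNegative (ι n)
  ι-nonNeg n = nonNegative (ι-mono-≤ 0 n ℕ.z≤n)

  -- From 2^t ≤ N^s follows s log N ≥ t log 2 ≥ 37 t / 60, so `h` yields s m + 1 ≤ q s log N. One
  -- half of the 1 pays for ε, the other for the error of the Riemann sums.
  log-> : ∀ N .{{_ : ℕ.NonZero N}} q c m s t .{{_ : ℕ.NonZero s}} .{{_ : NonNegative q}} → q ≤ ι c →
    2 ℕ.^ t ℕ.≤ N ℕ.^ s → ι (s ℕ.* m ℕ.+ 1) ≤ q * (+ 37 / 60) * ι t → fromℕ m <ᵣ q · log N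
  -- With ε = 1/(2s + 1) one has s ε < 1/2. The Riemann error is at most q (s + t)/(k + 1), which is
  -- below 1/2 once k ≥ 2 c (s + t), as q ≤ c.
  log-> N q c m s@(suc _) t q≤c 2^t≤N^s h = recip (2 ℕ.* s) , 0<recip (2 ℕ.* s) , 2 ℕ.* (c ℕ.* (s ℕ.+ t)) , λ k K≤k →
    ℚₚ.*-cancelˡ-<-nonNeg (ι s) {{ι-nonNeg s}} (bound k K≤k)
    where
    open ℚₚ.≤-Reasoning
    open +-*-Solver
    powers : ∀ k → (+ 37 / 60) * ι t ≤ ι s * (riemann N (suc k) + recip k) + ι t * recip k
    powers k = begin
      (+ 37 / 60) * ι t                              ≤⟨ ℚₚ.*-monoʳ-≤-nonNeg (ι t) {{ι-nonNeg t}} (37/60≤riemann-2 k) ⟩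
      (riemann 2 (suc k) + recip k) * ι t            ≡⟨ solve 3 (λ x r t → (x :+ r) :* t := t :* x :+ t :* r) refl (riemann 2 (suc k)) (recip k) (ι t) ⟩
      ι t * riemann 2 (suc k) + ι t * recip k        ≤⟨ ℚₚ.+-monoˡ-≤ (ι t * recip k) (ℚₚ.≤-trans (riemann-^-≥ 2 t k)
                                                          (ℚₚ.≤-trans (riemann-mono (suc k) 2^t≤N^s) (riemann-^-≤ N s k))) ⟩
      ι s * (riemann N (suc k) + recip k) + ι t * recip k  ∎
    bound : ∀ k → 2 ℕ.* (c ℕ.* (s ℕ.+ t)) ℕ.≤ k → ι s * (ι m + recip (2 ℕ.* s)) < ι s * (q * riemann N (suc k))
    bound k K≤k = begin-strict
      ι s * (ι m + recip (2 ℕ.* s))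
        ≡⟨ ℚₚ.*-distribˡ-+ (ι s) (ι m) (recip (2 ℕ.* s)) ⟩
      ι s * ι m + ι s * recip (2 ℕ.* s)
        <⟨ ℚₚ.+-monoʳ-< (ι s * ι m) (ι-*-recip-<½ s (2 ℕ.* s) ℕₚ.≤-refl) ⟩
      ι s * ι m + ½
        ≡⟨ trans (cong (_+ ½) (sym (ι-* s m))) (solve 1 (λ x → x :+ con ½ := (x :+ con 1ℚ) :- con ½) refl (ι (s ℕ.* m))) ⟩
      ι (s ℕ.* m) + 1ℚ - ½
        ≡⟨ cong (_- ½) (sym (ι-+ (s ℕ.* m) 1)) ⟩
      ι (s ℕ.* m ℕ.+ 1) - ½
        ≤⟨ ℚₚ.+-monoˡ-≤ (- ½) h ⟩
      q * (+ 37 / 60) * ι t - ½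
        ≡⟨ cong (_- ½) (ℚₚ.*-assoc q (+ 37 / 60) (ι t)) ⟩
      q * ((+ 37 / 60) * ι t) - ½
        ≤⟨ ℚₚ.+-monoˡ-≤ (- ½) (ℚₚ.*-monoˡ-≤-nonNeg q (powers k)) ⟩
      q * (ι s * (ρ + r) + ι t * r) - ½
        ≡⟨ solve 6 (λ q s t ρ r h → q :* (s :* (ρ :+ r) :+ t :* r) :- h := s :* (q :* ρ) :+ (q :* ((s :+ t) :* r) :- h)) refl q (ι s) (ι t) ρ r ½ ⟩
      ι s * (q * ρ) + (q * ((ι s + ι t) * r) - ½)
        <⟨ ℚₚ.+-monoʳ-< (ι s * (q * ρ)) (ℚₚ.+-monoˡ-< (- ½) small) ⟩
      ι s * (q * ρ) + (½ - ½)
        ≡⟨ ℚₚ.+-identityʳ (ι s * (q * ρ)) ⟩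
      ι s * (q * ρ) ∎
      where
      ρ = riemann N (suc k)
      r = recip k
      small : q * ((ι s + ι t) * r) < ½
      small = begin-strict
        q * ((ι s + ι t) * r)         ≡⟨ cong (λ z → q * (z * r)) (sym (ι-+ s t)) ⟩
        q * (ι (s ℕ.+ t) * r)         ≡⟨ ℚₚ.*-assoc q (ι (s ℕ.+ t)) r ⟨
        q * ι (s ℕ.+ t) * r           ≤⟨ ℚₚ.*-monoʳ-≤-nonNeg r {{nonNegative (ℚₚ.<⇒≤ (0<recip k))}} (ℚₚ.*-monoʳ-≤-nonNeg (ι (s ℕ.+ t)) {{ι-nonNeg (s ℕ.+ t)}} q≤c) ⟩
        ι c * ι (s ℕ.+ t) * r         ≡⟨ cong (_* r) (ι-* c (s ℕ.+ t)) ⟨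
        ι (c ℕ.* (s ℕ.+ t)) * r       <⟨ ι-*-recip-<½ (c ℕ.* (s ℕ.+ t)) k (ℕ.s≤s K≤k) ⟩
        ½                             ∎

  -- Replaces Q by the fraction u / v below it, which leaves a comparison of natural numbers.
  ι-≤-ratio : ∀ u v x t Q .{{_ : ℕ.NonZero v}} → ι u ≤ ι v * Q → v ℕ.* x ℕ.≤ u ℕ.* t → ι x ≤ Q * ι t
  ι-≤-ratio u v x t Q u≤vQ h = ℚₚ.*-cancelˡ-≤-pos (ι v) {{v-pos v}} (begin
    ι v * ι x        ≡⟨ ι-* v x ⟨
    ι (v ℕ.* x)      ≤⟨ ι-mono-≤ (v ℕ.* x) (u ℕ.* t) h ⟩
    ι (u ℕ.* t)      ≡⟨ ι-* u t ⟩
    ι u * ι t        ≤⟨ ℚₚ.*-monoʳ-≤-nonNeg (ι t) {{ι-nonNeg t}} u≤vQ ⟩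
    ι v * Q * ι t    ≡⟨ ℚₚ.*-assoc (ι v) Q (ι t) ⟩
    ι v * (Q * ι t)  ∎)
    where
    open ℚₚ.≤-Reasoning
    v-pos : ∀ v .{{_ : ℕ.NonZero v}} → Positive (ι v)
    v-pos (suc v) = positive (ℚₚ.<-≤-trans (ℚₚ.positive⁻¹ 1ℚ) (ι-mono-≤ 1 (suc v) (ℕ.s≤s ℕ.z≤n)))

-- Attainment of the supremum and its numerical bounds.

module Supremum where

  open Counting using (length-injection)
  open LargerSieve
  open Growth
  open LogarithmBounds
  open import Data.Integer as ℤ using (ℤ; +_; -[1+_])
  import Data.Integer.Properties as ℤₚ
  open import Data.List using (List; []; _∷_; length; filter; upTo)
  open import Data.List.Membership.Propositional using (_∈_; find; lose)
  open import Data.List.Membership.Propositional.Properties using (∈-upTo⁺; ∈-upTo⁻)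
  open import Data.List.Properties using (filter-all; length-upTo)
  open import Data.List.Relation.Unary.All as All using (All; []; _∷_)
  import Data.List.Relation.Unary.All.Properties as Allₚ
  open import Data.List.Relation.Unary.AllPairs as AllPairs using (AllPairs; []; _∷_; allPairs?)
  import Data.List.Relation.Unary.AllPairs.Properties as AllPairsₚ
  open import Data.List.Relation.Unary.Any using (Any; any?)
  import Data.List.Relation.Unary.Unique.Propositional.Properties as Uniqueₚ
  open import Data.Nat hiding (_/_)
  open import Data.Nat.Properties
  open import Data.Nat.Tactic.RingSolver using (solve-∀)
  open import Data.Product using (_×_; _,_; ∃-syntax)
  open import Data.Rational as ℚ using (ℚ; _/_)
  import Data.Rational.Properties as ℚₚ
  open import Function using (_∘_)
  open import Relation.Binary.PropositionalEquality
  open import Relation.Nullary using (Dec; yes; no; ¬?; _×-dec_)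
  open import Relation.Nullary.Decidable using (map′; from-yes)
  open import Relation.Unary using (Decidable)

  -- Constructively, the supremum comes from decidability: the search descends from b to the first k
  -- with P k.
  maximum-exists : ∀ {P : ℕ → Set} → Decidable P → P 0 → ∀ b → (∀ k → P k → k ≤ b) → ∃[ s ] P s × IsSupremum P s
  maximum-exists P? P0 zero    P≤ = 0 , P0 , P≤ , λ b ub → ub 0 P0
  maximum-exists P? P0 (suc b) P≤ with P? (suc b)
  ... | yes Pb = suc b , Pb , P≤ , λ c ub → ub (suc b) Pb
  ... | no ¬Pb = maximum-exists P? P0 b λ k Pk → ≤-pred (≤∧≢⇒< (P≤ k Pk) λ { refl → ¬Pb Pk })

  ∃-list? : ∀ {A : Set} {Q : List A → Set} (xs : List A) → Decidable Q → ∀ k →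
            Dec (∃[ S ] length S ≡ k × All (_∈ xs) S × Q S)
  ∃-list? xs Q? zero = map′ (λ q → [] , refl , [] , q) (λ { ([] , _ , _ , q) → q }) (Q? [])
  ∃-list? {Q = Q} xs Q? (suc k) = map′ from to (any? (λ x → ∃-list? xs (λ S → Q? (x ∷ S)) k) xs)
    where
    Tail : _ → Set
    Tail x = ∃[ S ] length S ≡ k × All (_∈ xs) S × Q (x ∷ S)
    from : Any Tail xs → ∃[ S ] length S ≡ suc k × All (_∈ xs) S × Q S
    from h = let x , x∈ , S , eq , S∈ , q = find h in x ∷ S , cong suc eq , x∈ ∷ S∈ , q
    to : ∃[ S ] length S ≡ suc k × All (_∈ xs) S × Q S → Any Tail xs
    to (x ∷ S , eq , x∈ ∷ S∈ , q) = lose x∈ (S , suc-injective eq , S∈ , q)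

  -- A root may be taken nonnegative and is then at most its square, so the search is finite.
  isSquare? : Decidable IsSquare
  isSquare? x = map′ (λ (k , _ , eq) → + k , eq) to (anyUpTo? (λ k → x ℤ.≟ + k ℤ.* + k) (suc ℤ.∣ x ∣))
    where
    k≤k*k : ∀ k → k ≤ k * k
    k≤k*k zero    = z≤n
    k≤k*k (suc k) = m≤m*n (suc k) (suc k)
    y*y : ∀ y → y ℤ.* y ≡ + ℤ.∣ y ∣ ℤ.* + ℤ.∣ y ∣
    y*y (+ _)    = refl
    y*y -[1+ _ ] = refl
    to : IsSquare x → ∃[ k ] k < suc ℤ.∣ x ∣ × x ≡ + k ℤ.* + k
    to (y , refl) = ℤ.∣ y ∣ , s≤s (subst (ℤ.∣ y ∣ ≤_) (sym (ℤₚ.abs-* y y)) (k≤k*k ℤ.∣ y ∣)) , y*y y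

  hasPropertyD? : ∀ n → Decidable (HasPropertyD n)
  hasPropertyD? n S = map′
    (λ (d , p , s) → record { distinct = d ; allPositive = p ; squares = s })
    (λ h → HasPropertyD.distinct h , HasPropertyD.allPositive h , HasPropertyD.squares h)
    (allPairs? (λ a b → ¬? (a ≟ b)) S ×-dec All.all? (1 ≤?_) S ×-dec allPairs? (λ a b → isSquare? (+ a ℤ.* + b ℤ.+ n)) S)

  -- Equivalent to the predicate in `IsC` by `restrict` and `unrestrict`, but with members from a
  -- finite list, hence decidable. The 0 in `upTo` is ruled out by `allPositive`.
  HasSize : ℤ → ℕ → Set
  HasSize n k = ∃[ S ] length S ≡ k × All (_∈ upTo (suc (ℤ.∣ n ∣ ^ 2))) S × HasPropertyD n S

  module _ (n : ℤ) where

    private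
      M = ℤ.∣ n ∣ ^ 2

      P : ℕ → Set
      P k = ∃[ S ] HasPropertyD n S × k ≡ ∣ S ∩[1, M ]∣

      in-range? : Decidable (λ a → 1 ≤ a × a ≤ M)
      in-range? a = (1 ≤? a) ×-dec (a ≤? M)

    restrict : ∀ {k} → P k → HasSize n k
    restrict (S , h , refl) = filter in-range? S , refl ,
      All.map (λ (_ , a≤M) → ∈-upTo⁺ (s≤s a≤M)) (Allₚ.all-filter in-range? S) ,
      record { distinct    = Uniqueₚ.filter⁺ in-range? (HasPropertyD.distinct h)
             ; allPositive = Allₚ.filter⁺ in-range? (HasPropertyD.allPositive h)
             ; squares     = AllPairsₚ.filter⁺ in-range? (HasPropertyD.squares h) }

    unrestrict : ∀ {k} → HasSize n k → P k
    unrestrict (S , refl , S∈ , h) = S , h , sym (cong length (filter-all in-range?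
      (All.zip (HasPropertyD.allPositive h , All.map (≤-pred ∘ ∈-upTo⁻) S∈))))

    hasSize-≤ : ∀ k → HasSize n k → k ≤ suc M
    hasSize-≤ k (S , refl , S∈ , h) = subst (length S ≤_) (length-upTo (suc M))
      (length-injection (upTo (suc M)) (HasPropertyD.distinct h) _≡_ (λ {x} x∈ → x , All.lookup S∈ x∈ , refl)
        λ _ _ eq eq′ → trans eq (sym eq′))

    -- A set attaining the supremum is returned as well, since the sieve is applied to it.
    C-exists : ∃[ C ] HasSize n C × IsC n C
    C-exists =
      let C , PC , sup = maximum-exists
            (λ k → map′ unrestrict restrict (∃-list? (upTo (suc M)) (hasPropertyD? n) k))
            ([] , record { distinct = [] ; allPositive = [] ; squares = [] } , refl)
            (suc M) (λ k → hasSize-≤ k ∘ restrict)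
      in C , restrict PC , sup

  dominates⇒log-> : ∀ n (let N = ℤ.∣ n ∣) .{{_ : NonZero N}} u v c q .{{_ : NonZero u}} .{{_ : NonZero v}} .{{_ : ℚ.NonNegative q}} →
    ι u ℚ.≤ ι v ℚ.* (q ℚ.* (+ 37 / 60)) → q ℚ.≤ ι c →
    ∀ J → Dominates u v J → HasSize n (9 + J) → fromℕ (9 + J) <ᵣ q · log N
  dominates⇒log-> n u v c q u≤vq q≤c J dominates (S , size , S∈ , h) =
    log-> N q c (9 + J) s t q≤c 2^t≤N^s (ι-≤-ratio u v (s * m + 1) t _ u≤vq v[sm+1]≤ut)
    where
    N = ℤ.∣ n ∣
    m = 9 + J
    s = m * m * 16
    -- The truncated subtraction is exact by `error≤main`; cancelling 2^Y in the sieve inequality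
    -- leaves 2^t ≤ N^s.
    t = mainTerm J ∸ errorTerm J
    error≤main : errorTerm J ≤ mainTerm J
    error≤main = *-cancelˡ-≤ u (m+n≤o⇒n≤o _ dominates)
    v[sm+1]≤ut : v * (s * m + 1) ≤ u * t
    v[sm+1]≤ut = subst₂ _≤_ (cong (λ z → v * (z + 1)) (lemma m)) (sym (*-distribˡ-∸ u (mainTerm J) (errorTerm J)))
      (m+n≤o⇒m≤o∸n _ dominates)
      where
      lemma : ∀ m → 16 * (m * (m * m)) ≡ m * m * 16 * m
      lemma = solve-∀
    sieved : 2 ^ mainTerm J ≤ N ^ s * 2 ^ errorTerm J
    sieved = subst (λ l → 2 ^ mainTerm J ≤ N ^ (l * l * 16) * 2 ^ errorTerm J) size
      (Sieve.sieve n (HasPropertyD.squares h) J size 16 131 i^32≤2^[131+i] (HasPropertyD.distinct h) (All.map (≤-pred ∘ ∈-upTo⁻) S∈))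
    2^t≤N^s : 2 ^ t ≤ N ^ s
    2^t≤N^s = *-cancelʳ-≤ (2 ^ t) (N ^ s) (2 ^ errorTerm J) {{m^n≢0 2 (errorTerm J)}}
      (subst (_≤ N ^ s * 2 ^ errorTerm J) (trans (cong (2 ^_) (sym (m∸n+n≡m error≤main))) (^-distribˡ-+-* 2 t (errorTerm J))) sieved)

  size-<-11006/1000 : ∀ n .{{_ : ℤ.NonZero n}} → 400 < ℤ.∣ n ∣ → ∀ {C} → HasSize n C →
    fromℕ C <ᵣ (+ 11006 / 1000) · log ℤ.∣ n ∣
  size-<-11006/1000 n N>400 {C} hasSize = by-size (55 ≤? C)
    where
    q = + 11006 / 1000
    Q = q ℚ.* (+ 37 / 60)
    ratio : ι 13 ℚ.≤ ι 2 ℚ.* Q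
    ratio = from-yes (ι 13 ℚₚ.≤? ι 2 ℚ.* Q)
    q≤12 : q ℚ.≤ ι 12
    q≤12 = from-yes (q ℚₚ.≤? ι 12)
    by-size : Dec (55 ≤ C) → fromℕ C <ᵣ q · log ℤ.∣ n ∣
    by-size (yes 55≤C) = subst (λ C → fromℕ C <ᵣ q · log ℤ.∣ n ∣) eq
      (dominates⇒log-> n 13 2 12 q ratio q≤12 (C ∸ 55 + 46) (dominates-13/2 (C ∸ 55)) (subst (HasSize n) (sym eq) hasSize))
      where
      eq : 9 + (C ∸ 55 + 46) ≡ C
      eq = trans (+-comm 9 _) (trans (+-assoc (C ∸ 55) 46 9) (m∸n+n≡m 55≤C))
    -- For C ≤ 54 the size of N suffices: 2^17 ≤ 401² ≤ N², and 2 (2 · 54 + 1) = 218 ≤ 221 = 13 ·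
    -- 17.
    by-size (no C<55) = log-> ℤ.∣ n ∣ q 12 C 2 17 q≤12
      (≤-trans (≤ᵇ⇒≤ (2 ^ 17) (401 ^ 2) _) (^-monoˡ-≤ 2 N>400))
      (ι-≤-ratio 13 2 (2 * C + 1) 17 Q ratio
        (≤-trans (*-monoʳ-≤ 2 (+-monoˡ-≤ 1 (*-monoʳ-≤ 2 (≤-pred (≰⇒> C<55))))) (≤ᵇ⇒≤ (2 * (2 * 54 + 1)) (13 * 17) _)))

  size-<-837/100 : ∀ n .{{_ : ℤ.NonZero n}} → 10 ^ 100 ≤ ℤ.∣ n ∣ → ∀ {C} → HasSize n C →
    fromℕ C <ᵣ (+ 837 / 100) · log ℤ.∣ n ∣
  size-<-837/100 n N≥ {C} hasSize = by-size (100 ≤? C)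
    where
    q = + 837 / 100
    Q = q ℚ.* (+ 37 / 60)
    ratio : ι 5 ℚ.≤ ι 1 ℚ.* Q
    ratio = from-yes (ι 5 ℚₚ.≤? ι 1 ℚ.* Q)
    q≤9 : q ℚ.≤ ι 9
    q≤9 = from-yes (q ℚₚ.≤? ι 9)
    by-size : Dec (100 ≤ C) → fromℕ C <ᵣ q · log ℤ.∣ n ∣
    by-size (yes 100≤C) = subst (λ C → fromℕ C <ᵣ q · log ℤ.∣ n ∣) eq
      (dominates⇒log-> n 5 1 9 q ratio q≤9 (C ∸ 100 + 91) (dominates-5 (C ∸ 100)) (subst (HasSize n) (sym eq) hasSize))
      where
      eq : 9 + (C ∸ 100 + 91) ≡ C
      eq = trans (+-comm 9 _) (trans (+-assoc (C ∸ 100) 91 9) (m∸n+n≡m 100≤C))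
    -- For C ≤ 99 one uses 2^332 ≤ 10^100 ≤ N and 99 + 1 ≤ 5 · 332.
    by-size (no C<100) = log-> ℤ.∣ n ∣ q 9 C 1 332 q≤9
      (≤-trans (≤ᵇ⇒≤ (2 ^ 332) (10 ^ 100) _) (≤-trans N≥ (≤-reflexive (sym (*-identityʳ ℤ.∣ n ∣)))))
      (ι-≤-ratio 5 1 (1 * C + 1) 332 Q ratio
        (≤-trans (*-monoʳ-≤ 1 (+-monoˡ-≤ 1 (*-monoʳ-≤ 1 (≤-pred (≰⇒> C<100))))) (≤ᵇ⇒≤ (1 * (1 * 99 + 1)) (5 * 332) _)))

open import Data.Integer using (ℤ; +_; ∣_∣; NonZero)
open import Data.Nat using (ℕ; _<_; _≤_; _^_)
open import Data.Product using (∃-syntax; _×_; _,_)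
open import Data.Rational using (_/_)

proposition1 : (n : ℤ) .{{_ : NonZero n}} →
    ∃[ C ] IsC n C
    × (400 < ∣ n ∣ → fromℕ C <ᵣ (+ 11006 / 1000) · log ∣ n ∣)
    × (10 ^ 100 ≤ ∣ n ∣ → fromℕ C <ᵣ (+ 837 / 100) · log ∣ n ∣)
proposition1 n =
  let C , hasSize , isC = Supremum.C-exists n in
  C , isC , (λ N>400 → Supremum.size-<-11006/1000 n N>400 hasSize) , λ N≥10^100 → Supremum.size-<-837/100 n N≥10^100 hasSize
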